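{- Let $G$ be a finite simple graph on $n\ge1$ vertices with clique number $\omega=\omega(G)$, and let $M=(M_{uv})_{u,v\in V(G)}$ be a doubly nonnegative real matrix indexed by $V(G)$. Then $$2\sum_{uv\in E(G)}\sqrt{M_{uv}}\le\left(1-\frac1\omega\right)n\cdot\sqrt{\sum_{u,v\in V(G)}M_{uv}}.$$
   Context: Graphs are finite and simple. The clique number $\omega(G)$ is the largest number of vertices in a clique of $G$. A real symmetric matrix $M$ is doubly nonnegative if it is positive semidefinite and all of its entries are nonnegative. The sum on the left is over undirected edges, each counted once; the sum on the right is over all ordered pairs $(u,v)\in V(G)\times V(G)$, including $u=v$. -}

module Defs where

open import Algebra.Bundles.Raw using (RawMonoid)
open import Algebra.Definitions.RawMonoid using (sum)
open import Data.Bool.Base using (if_then_else_)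
open import Data.Empty using (⊥-elim)
open import Data.Fin.Base as Fin using (Fin)
import Data.Fin.Properties as Fin
open import Data.Fin.Subset using (Subset; _∈_; ⁅_⁆; ∣_∣)
open import Data.Fin.Subset.Properties using (x∈⁅y⁆⇒x≡y; ∣⁅x⁆∣≡1)
open import Data.Integer.Base as ℤ using (+_)
import Data.Integer.Properties as ℤ
open import Data.Nat.Base as ℕ using (ℕ; zero; suc)
import Data.Nat.Properties as ℕ
open import Data.Product.Base using (∃-syntax; _×_; _,_; proj₁; proj₂)
open import Data.Rational.Base as ℚ using (ℚ; 0ℚ; 1ℚ; ½)
import Data.Rational.Properties as ℚ
open import Data.Rational.Solver using (module +-*-Solver)
import Data.Rational.Unnormalised.Base as ℚᵘ
import Data.Rational.Unnormalised.Properties as ℚᵘ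
open import Data.Sum.Base using (_⊎_; inj₁; inj₂; map₁)
open import Level using (0ℓ)
open import Relation.Binary.Core using (Rel)
open import Relation.Binary.Definitions using (Decidable; Symmetric; Irreflexive)
open import Relation.Binary.PropositionalEquality using (_≡_; _≢_; refl; sym; trans; cong; cong₂; subst; subst₂)
open import Relation.Nullary.Decidable using (Dec; yes; no; does; _×-dec_)
open import Relation.Nullary.Negation using (¬_)

------------------------------------------------------------------------
-- Rational estimates used to construct the real operations

module Rational where

  open import Data.Rational.Base hiding (∣_∣)
  open ℚ.≤-Reasoning
  open +-*-Solver using (solve; _:=_; _:+_; _:*_; :-_; _:-_; con)

  ∣∣-intro : ∀ {p ε} → p ≤ ε → - p ≤ ε → ℚ.∣ p ∣ ≤ ε
  ∣∣-intro {p} {ε} p≤ε -p≤ε with ℚ.∣p∣≡p∨∣p∣≡-p p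
  ... | inj₁ eq = subst (_≤ ε) (sym eq) p≤ε
  ... | inj₂ eq = subst (_≤ ε) (sym eq) -p≤ε

  p≤∣p∣ : ∀ p → p ≤ ℚ.∣ p ∣
  p≤∣p∣ p with ℚ.≤-total 0ℚ p
  ... | inj₁ 0≤p = ℚ.≤-reflexive (sym (ℚ.0≤p⇒∣p∣≡p 0≤p))
  ... | inj₂ p≤0 = ℚ.≤-trans p≤0 (ℚ.0≤∣p∣ p)

  p-q≤r⇒p≤q+r : ∀ p q {r} → p - q ≤ r → p ≤ q + r
  p-q≤r⇒p≤q+r p q {r} h = begin
    p            ≡⟨ solve 2 (λ a b → a := b :+ (a :- b)) refl p q ⟩
    q + (p - q)  ≤⟨ ℚ.+-monoʳ-≤ q h ⟩
    q + r        ∎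

  p≤q+r⇒p-q≤r : ∀ p q {r} → p ≤ q + r → p - q ≤ r
  p≤q+r⇒p-q≤r p q {r} h = begin
    p - q        ≤⟨ ℚ.+-monoˡ-≤ (- q) h ⟩
    q + r - q    ≡⟨ solve 2 (λ b c → b :+ c :- b := c) refl q r ⟩
    r            ∎

  -‿swap : ∀ p q → - (p - q) ≡ q - p
  -‿swap = solve 2 (λ a b → :- (a :- b) := b :- a) refl

  halves : ∀ ε → ε * ½ + ε * ½ ≡ ε
  halves ε = trans (sym (ℚ.*-distribˡ-+ ε ½ ½)) (ℚ.*-identityʳ ε)

  *-pos : ∀ {p q} → 0ℚ < p → 0ℚ < q → 0ℚ < p * q
  *-pos {p} {q} 0<p 0<q =
    ℚ.positive⁻¹ (p * q) {{ℚ.pos*pos⇒pos p {{positive 0<p}} q {{positive 0<q}}}}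

  *-nonNeg : ∀ {p q} → 0ℚ ≤ p → 0ℚ ≤ q → 0ℚ ≤ p * q
  *-nonNeg {p} {q} 0≤p 0≤q =
    ℚ.nonNegative⁻¹ (p * q) {{ℚ.nonNeg*nonNeg⇒nonNeg p {{nonNegative 0≤p}} q {{nonNegative 0≤q}}}}

  half-pos : ∀ {ε} → 0ℚ < ε → 0ℚ < ε * ½
  half-pos 0<ε = *-pos 0<ε (ℚ.positive⁻¹ ½)

  *-mono-≤ : ∀ {p q r s} → 0ℚ ≤ r → 0ℚ ≤ q → p ≤ q → r ≤ s → p * r ≤ q * s
  *-mono-≤ {p} {q} {r} {s} 0≤r 0≤q p≤q r≤s = begin
    p * r  ≤⟨ ℚ.*-monoʳ-≤-nonNeg r {{nonNegative 0≤r}} p≤q ⟩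
    q * r  ≤⟨ ℚ.*-monoˡ-≤-nonNeg q {{nonNegative 0≤q}} r≤s ⟩
    q * s  ∎

  square-mono-≤ : ∀ {p q} → 0ℚ ≤ p → p ≤ q → p * p ≤ q * q
  square-mono-≤ 0≤p p≤q = *-mono-≤ 0≤p (ℚ.≤-trans 0≤p p≤q) p≤q p≤q

  square-cancel-< : ∀ {p q} → 0ℚ ≤ q → p * p < q * q → p < q
  square-cancel-< {p} {q} 0≤q h with p ℚ.<? q
  ... | yes p<q = p<q
  ... | no p≮q = ⊥-elim (ℚ.<-irrefl refl (ℚ.<-≤-trans h (square-mono-≤ 0≤q (ℚ.≮⇒≥ p≮q))))

  *-diff-bound : ∀ {a b c d A B δ} → ℚ.∣ a ∣ ≤ A → ℚ.∣ d ∣ ≤ B →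
                 ℚ.∣ b - d ∣ ≤ δ → ℚ.∣ a - c ∣ ≤ δ →
                 ℚ.∣ a * b - c * d ∣ ≤ (A + B) * δ
  *-diff-bound {a} {b} {c} {d} {A} {B} {δ} a≤A d≤B b-d a-c = begin
    ℚ.∣ a * b - c * d ∣
      ≡⟨ cong ℚ.∣_∣ (solve 4 (λ a b c d → a :* b :- c :* d := a :* (b :- d) :+ d :* (a :- c)) refl a b c d) ⟩
    ℚ.∣ a * (b - d) + d * (a - c) ∣
      ≤⟨ ℚ.∣p+q∣≤∣p∣+∣q∣ (a * (b - d)) (d * (a - c)) ⟩
    ℚ.∣ a * (b - d) ∣ + ℚ.∣ d * (a - c) ∣
      ≡⟨ cong₂ _+_ (ℚ.∣p*q∣≡∣p∣*∣q∣ a (b - d)) (ℚ.∣p*q∣≡∣p∣*∣q∣ d (a - c)) ⟩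
    ℚ.∣ a ∣ * ℚ.∣ b - d ∣ + ℚ.∣ d ∣ * ℚ.∣ a - c ∣
      ≤⟨ ℚ.+-mono-≤
           (*-mono-≤ (ℚ.0≤∣p∣ (b - d)) (ℚ.≤-trans (ℚ.0≤∣p∣ a) a≤A) a≤A b-d)
           (*-mono-≤ (ℚ.0≤∣p∣ (a - c)) (ℚ.≤-trans (ℚ.0≤∣p∣ d) d≤B) d≤B a-c) ⟩
    A * δ + B * δ
      ≡⟨ sym (ℚ.*-distribʳ-+ δ A B) ⟩
    (A + B) * δ ∎

  divide : ∀ {ε C} → 0ℚ < ε → 0ℚ < C → ∃[ δ ] (0ℚ < δ × C * δ ≡ ε)
  divide {ε} {C} 0<ε 0<C =
    ε * C⁻¹ , *-pos 0<ε (ℚ.positive⁻¹ C⁻¹ {{ℚ.1/pos⇒pos C {{positive 0<C}}}}) ,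
    trans (solve 3 (λ c e i → c :* (e :* i) := e :* (c :* i)) refl C ε C⁻¹)
      (trans (cong (ε *_) (ℚ.*-inverseʳ C {{ℚ.>-nonZero 0<C}})) (ℚ.*-identityʳ ε))
    where C⁻¹ = (1/ C) {{ℚ.>-nonZero 0<C}}

  fromℕ : ℕ → ℚ
  fromℕ k = + k / 1

  1/1+_ : ℕ → ℚ
  1/1+ n = + 1 / suc n

  toℚᵘ-/ : ∀ i n → toℚᵘ (i / suc n) ℚᵘ.≃ ℚᵘ.mkℚᵘ i n
  toℚᵘ-/ i n = ℚ.toℚᵘ-fromℚᵘ (ℚᵘ.mkℚᵘ i n)

  fromℕ-suc : ∀ k → fromℕ (suc k) ≡ fromℕ k + 1ℚ
  fromℕ-suc k = ℚ.toℚᵘ-injective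
    (ℚᵘ.≃-trans (toℚᵘ-/ (+ suc k) 0)
    (ℚᵘ.≃-trans (ℚᵘ.*≡* (cong (ℤ._* + 1) (trans (cong +_ (ℕ.+-comm 1 k)) (cong (ℤ._+ + 1) (sym (ℤ.*-identityʳ (+ k)))))))
    (ℚᵘ.≃-sym (ℚᵘ.≃-trans (ℚ.toℚᵘ-homo-+ (fromℕ k) 1ℚ)
      (ℚᵘ.+-congˡ (toℚᵘ 1ℚ) (toℚᵘ-/ (+ k) 0))))))

  fromℕ-+ : ∀ j k → fromℕ (j ℕ.+ k) ≡ fromℕ j + fromℕ k
  fromℕ-+ zero    k = sym (ℚ.+-identityˡ (fromℕ k))
  fromℕ-+ (suc j) k = begin-equality
    fromℕ (suc (j ℕ.+ k))      ≡⟨ fromℕ-suc (j ℕ.+ k) ⟩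
    fromℕ (j ℕ.+ k) + 1ℚ       ≡⟨ cong (_+ 1ℚ) (fromℕ-+ j k) ⟩
    fromℕ j + fromℕ k + 1ℚ     ≡⟨ solve 3 (λ a b c → a :+ b :+ c := a :+ c :+ b) refl (fromℕ j) (fromℕ k) 1ℚ ⟩
    fromℕ j + 1ℚ + fromℕ k     ≡⟨ cong (_+ fromℕ k) (sym (fromℕ-suc j)) ⟩
    fromℕ (suc j) + fromℕ k    ∎

  fromℕ-* : ∀ j k → fromℕ (j ℕ.* k) ≡ fromℕ j * fromℕ k
  fromℕ-* zero    k = sym (ℚ.*-zeroˡ (fromℕ k))
  fromℕ-* (suc j) k = begin-equality
    fromℕ (k ℕ.+ j ℕ.* k)         ≡⟨ fromℕ-+ k (j ℕ.* k) ⟩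
    fromℕ k + fromℕ (j ℕ.* k)     ≡⟨ cong (λ r → fromℕ k + r) (fromℕ-* j k) ⟩
    fromℕ k + fromℕ j * fromℕ k   ≡⟨ solve 2 (λ a b → b :+ a :* b := (a :+ con 1ℚ) :* b) refl (fromℕ j) (fromℕ k) ⟩
    (fromℕ j + 1ℚ) * fromℕ k      ≡⟨ cong (_* fromℕ k) (sym (fromℕ-suc j)) ⟩
    fromℕ (suc j) * fromℕ k       ∎

  0≤fromℕ : ∀ k → 0ℚ ≤ fromℕ k
  0≤fromℕ k = ℚ.nonNegative⁻¹ (fromℕ k) {{ℚ.normalize-nonNeg k 1}}

  0<1/1+n : ∀ n → 0ℚ < 1/1+ n
  0<1/1+n n = ℚ.positive⁻¹ (1/1+ n) {{ℚ.normalize-pos 1 (suc n)}}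

  1/1+-inverse : ∀ n → fromℕ (suc n) * 1/1+ n ≡ 1ℚ
  1/1+-inverse n = ℚ.toℚᵘ-injective
    (ℚᵘ.≃-trans (ℚ.toℚᵘ-homo-* (fromℕ (suc n)) (1/1+ n))
    (ℚᵘ.≃-trans (ℚᵘ.*-cong (toℚᵘ-/ (+ suc n) 0) (toℚᵘ-/ (+ 1) n))
    (ℚᵘ.*≡* (cong +_ (trans (ℕ.*-identityʳ (suc n ℕ.* 1)) (sym (trans (ℕ.*-identityˡ (1 ℕ.* suc n)) (ℕ.*-comm 1 (suc n)))))))))

  1/1+-antimono : ∀ {m n} → m ℕ.≤ n → 1/1+ n ≤ 1/1+ m
  1/1+-antimono {m} {n} m≤n = ℚ.toℚᵘ-cancel-≤
    (ℚᵘ.≤-respˡ-≃ (ℚᵘ.≃-sym (toℚᵘ-/ (+ 1) n))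
    (ℚᵘ.≤-respʳ-≃ (ℚᵘ.≃-sym (toℚᵘ-/ (+ 1) m))
    (ℚᵘ.*≤* (ℤ.*-monoˡ-≤-nonNeg (+ 1) (ℤ.+≤+ (ℕ.s≤s m≤n))))))

  archimedean : ∀ {ε} → 0ℚ < ε → ∃[ N ] (1/1+ N ≤ ε)
  archimedean {ε@(mkℚ (+ suc a) d _)} _ = d , ℚ.toℚᵘ-cancel-≤
    (ℚᵘ.≤-respˡ-≃ (ℚᵘ.≃-sym (toℚᵘ-/ (+ 1) d))
    (ℚᵘ.*≤* (ℤ.*-monoʳ-≤-nonNeg (+ suc d) {+ 1} {+ suc a} (ℤ.+≤+ (ℕ.s≤s ℕ.z≤n)))))
  archimedean {mkℚ (+ zero) d _} (*<* (ℤ.+<+ ()))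
  archimedean {mkℚ (ℤ.-[1+ a ]) d _} (*<* ())

  q≤∣↥q∣ : ∀ q → q ≤ fromℕ ℤ.∣ ↥ q ∣
  q≤∣↥q∣ q@(mkℚ i d _) = ℚ.toℚᵘ-cancel-≤
    (ℚᵘ.≤-respʳ-≃ (ℚᵘ.≃-sym (toℚᵘ-/ (+ ℤ.∣ i ∣) 0)) (ℚᵘ.*≤* (bound i)))
    where
    bound : ∀ i → i ℤ.* + 1 ℤ.≤ + ℤ.∣ i ∣ ℤ.* + suc d
    bound (+ k)        = subst₂ ℤ._≤_ (ℤ.pos-* k 1) (ℤ.pos-* k (suc d)) (ℤ.+≤+ (ℕ.*-monoʳ-≤ k (ℕ.s≤s ℕ.z≤n)))
    bound ℤ.-[1+ k ]   = ℤ.-≤+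

  -- The largest k ≤ K satisfying P, or 0 if there is none.
  largest : {P : ℕ → Set} → (∀ k → Dec (P k)) → ℕ → ℕ
  largest P? zero    = zero
  largest P? (suc k) = if does (P? (suc k)) then suc k else largest P? k

  largest-zero⊎sat : ∀ {P : ℕ → Set} (P? : ∀ k → Dec (P k)) K →
                     largest P? K ≡ 0 ⊎ P (largest P? K)
  largest-zero⊎sat P? zero = inj₁ refl
  largest-zero⊎sat P? (suc k) with P? (suc k)
  ... | yes p = inj₂ p
  ... | no _  = largest-zero⊎sat P? k

  largest-max : ∀ {P : ℕ → Set} (P? : ∀ k → Dec (P k)) K →
                ¬ P (suc K) → ¬ P (suc (largest P? K))
  largest-max P? zero    ¬p = ¬p
  largest-max P? (suc k) ¬p with P? (suc k)
  ... | yes _ = ¬p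
  ... | no ¬q = largest-max P? k ¬q

  -- value is the largest multiple of 1/(n+1) whose square is at most q
  -- (and 0 if q < 0).  The search bound (n+1)(∣↥q∣+1) is large enough
  -- because q ≤ ∣↥q∣ < (∣↥q∣+1)².
  module SqrtApprox (n : ℕ) (q : ℚ) where

    grid : ℕ → ℚ
    grid k = fromℕ k * 1/1+ n

    below? : ∀ k → Dec (grid k * grid k ≤ q)
    below? k = grid k * grid k ℚ.≤? q

    index : ℕ
    index = largest below? (suc n ℕ.* suc ℤ.∣ ↥ q ∣)

    value : ℚ
    value = grid index

    grid-suc : ∀ k → grid (suc k) ≡ grid k + 1/1+ n
    grid-suc k = trans (cong (_* 1/1+ n) (fromℕ-suc k))
      (solve 2 (λ a b → (a :+ con 1ℚ) :* b := a :* b :+ b) refl (fromℕ k) (1/1+ n))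

    0≤value : 0ℚ ≤ value
    0≤value = *-nonNeg (0≤fromℕ index) (ℚ.<⇒≤ (0<1/1+n n))

    value≡0⊎value²≤q : value ≡ 0ℚ ⊎ value * value ≤ q
    value≡0⊎value²≤q = map₁ (λ eq → trans (cong grid eq) (ℚ.*-zeroˡ (1/1+ n)))
      (largest-zero⊎sat below? (suc n ℕ.* suc ℤ.∣ ↥ q ∣))

    private
      b : ℕ
      b = ℤ.∣ ↥ q ∣

      grid-bound : grid (suc n ℕ.* suc b) ≡ fromℕ b + 1ℚ
      grid-bound = begin-equality
        fromℕ (suc n ℕ.* suc b) * 1/1+ n            ≡⟨ cong (_* 1/1+ n) (fromℕ-* (suc n) (suc b)) ⟩
        fromℕ (suc n) * fromℕ (suc b) * 1/1+ n      ≡⟨ solve 3 (λ x y z → x :* y :* z := x :* z :* y) refl (fromℕ (suc n)) (fromℕ (suc b)) (1/1+ n) ⟩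
        fromℕ (suc n) * 1/1+ n * fromℕ (suc b)      ≡⟨ cong (_* fromℕ (suc b)) (1/1+-inverse n) ⟩
        1ℚ * fromℕ (suc b)                          ≡⟨ ℚ.*-identityˡ (fromℕ (suc b)) ⟩
        fromℕ (suc b)                               ≡⟨ fromℕ-suc b ⟩
        fromℕ b + 1ℚ                                ∎

      b≤[b+1]² : fromℕ b + 1ℚ ≤ (fromℕ b + 1ℚ) * (fromℕ b + 1ℚ)
      b≤[b+1]² = begin
        fromℕ b + 1ℚ                        ≡⟨ sym (ℚ.*-identityʳ (fromℕ b + 1ℚ)) ⟩
        (fromℕ b + 1ℚ) * 1ℚ                 ≤⟨ *-mono-≤ (ℚ.nonNegative⁻¹ 1ℚ) (ℚ.≤-trans (ℚ.nonNegative⁻¹ 1ℚ) 1≤b+1) ℚ.≤-refl 1≤b+1 ⟩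
        (fromℕ b + 1ℚ) * (fromℕ b + 1ℚ)     ∎
        where
        1≤b+1 : 1ℚ ≤ fromℕ b + 1ℚ
        1≤b+1 = subst (_≤ fromℕ b + 1ℚ) (ℚ.+-identityˡ 1ℚ) (ℚ.+-monoˡ-≤ 1ℚ (0≤fromℕ b))

      bound-fails : ¬ (grid (suc (suc n ℕ.* suc b)) * grid (suc (suc n ℕ.* suc b)) ≤ q)
      bound-fails h = ℚ.<-irrefl refl (begin-strict
        q                                       ≤⟨ q≤∣↥q∣ q ⟩
        fromℕ b                                 ≡⟨ sym (ℚ.+-identityʳ (fromℕ b)) ⟩
        fromℕ b + 0ℚ                            <⟨ ℚ.+-monoʳ-< (fromℕ b) (ℚ.positive⁻¹ 1ℚ) ⟩
        fromℕ b + 1ℚ                            ≤⟨ b≤[b+1]² ⟩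
        (fromℕ b + 1ℚ) * (fromℕ b + 1ℚ)         ≡⟨ cong₂ _*_ (sym grid-bound) (sym grid-bound) ⟩
        grid K * grid K                         ≤⟨ square-mono-≤ 0≤gridK gridK≤ ⟩
        grid (suc K) * grid (suc K)             ≤⟨ h ⟩
        q                                       ∎)
        where
        K = suc n ℕ.* suc b
        0≤gridK : 0ℚ ≤ grid K
        0≤gridK = *-nonNeg (0≤fromℕ K) (ℚ.<⇒≤ (0<1/1+n n))
        gridK≤ : grid K ≤ grid (suc K)
        gridK≤ = begin
          grid K             ≡⟨ sym (ℚ.+-identityʳ (grid K)) ⟩
          grid K + 0ℚ        ≤⟨ ℚ.+-monoʳ-≤ (grid K) (ℚ.<⇒≤ (0<1/1+n n)) ⟩
          grid K + 1/1+ n    ≡⟨ sym (grid-suc K) ⟩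
          grid (suc K)       ∎

    q<[value+1/1+n]² : q < (value + 1/1+ n) * (value + 1/1+ n)
    q<[value+1/1+n]² = subst (λ s → q < s * s) (grid-suc index)
      (ℚ.≰⇒> (largest-max below? (suc n ℕ.* suc ℤ.∣ ↥ q ∣) bound-fails))

  opaque

    √≈ : ℕ → ℚ → ℚ
    √≈ = SqrtApprox.value

    0≤√≈ : ∀ n q → 0ℚ ≤ √≈ n q
    0≤√≈ = SqrtApprox.0≤value

    √≈≡0⊎√≈²≤ : ∀ n q → √≈ n q ≡ 0ℚ ⊎ √≈ n q * √≈ n q ≤ q
    √≈≡0⊎√≈²≤ = SqrtApprox.value≡0⊎value²≤q

    <[√≈+1/1+n]² : ∀ n q → q < (√≈ n q + 1/1+ n) * (√≈ n q + 1/1+ n)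
    <[√≈+1/1+n]² = SqrtApprox.q<[value+1/1+n]²

  √≈-close : ∀ m n {p q δ} → 0ℚ ≤ δ → p - q ≤ δ * δ → √≈ m p ≤ √≈ n q + (1/1+ n + δ)
  √≈-close m n {p} {q} {δ} 0≤δ p-q≤δ² = case (√≈≡0⊎√≈²≤ m p)
    where
    t = √≈ n q + 1/1+ n
    u = √≈ n q + (1/1+ n + δ)
    0≤t : 0ℚ ≤ t
    0≤t = ℚ.+-mono-≤ (0≤√≈ n q) (ℚ.<⇒≤ (0<1/1+n n))
    0≤u : 0ℚ ≤ u
    0≤u = ℚ.+-mono-≤ (0≤√≈ n q) (ℚ.+-mono-≤ (ℚ.<⇒≤ (0<1/1+n n)) 0≤δ)
    case : √≈ m p ≡ 0ℚ ⊎ √≈ m p * √≈ m p ≤ p → √≈ m p ≤ u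
    case (inj₁ eq)   = subst (_≤ u) (sym eq) 0≤u
    case (inj₂ s²≤p) = ℚ.<⇒≤ (square-cancel-< 0≤u (begin-strict
      √≈ m p * √≈ m p                   ≤⟨ s²≤p ⟩
      p                                 ≤⟨ p-q≤r⇒p≤q+r p q p-q≤δ² ⟩
      q + δ * δ                         <⟨ ℚ.+-monoˡ-< (δ * δ) (<[√≈+1/1+n]² n q) ⟩
      t * t + δ * δ                     ≡⟨ sym (ℚ.+-identityʳ (t * t + δ * δ)) ⟩
      t * t + δ * δ + 0ℚ                ≤⟨ ℚ.+-monoʳ-≤ (t * t + δ * δ) (ℚ.+-mono-≤ (*-nonNeg 0≤t 0≤δ) (*-nonNeg 0≤t 0≤δ)) ⟩
      t * t + δ * δ + (t * δ + t * δ)   ≡⟨ solve 3 (λ s i d → (s :+ i) :* (s :+ i) :+ d :* d :+ ((s :+ i) :* d :+ (s :+ i) :* d)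
                                                    := (s :+ (i :+ d)) :* (s :+ (i :+ d))) refl (√≈ n q) (1/1+ n) δ ⟩
      u * u                             ∎))

  √≈-square-lower : ∀ n {q ε} → 0ℚ ≤ ε → 0ℚ ≤ q + ε → √≈ n q * √≈ n q ≤ q + ε
  √≈-square-lower n {q} {ε} 0≤ε 0≤q+ε = case (√≈≡0⊎√≈²≤ n q)
    where
    case : √≈ n q ≡ 0ℚ ⊎ √≈ n q * √≈ n q ≤ q → √≈ n q * √≈ n q ≤ q + ε
    case (inj₁ eq)   = subst (_≤ q + ε) (sym (trans (cong (_* √≈ n q) eq) (ℚ.*-zeroˡ (√≈ n q)))) 0≤q+ε
    case (inj₂ s²≤q) = ℚ.≤-trans s²≤q (subst (_≤ q + ε) (ℚ.+-identityʳ q) (ℚ.+-monoʳ-≤ q 0≤ε))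

  √≈-square-upper : ∀ n {q B} → ℚ.∣ √≈ n q ∣ ≤ B → q ≤ √≈ n q * √≈ n q + (B + B + 1ℚ) * 1/1+ n
  √≈-square-upper n {q} {B} s≤B = begin
    q                              ≤⟨ ℚ.<⇒≤ (<[√≈+1/1+n]² n q) ⟩
    (s + i) * (s + i)              ≡⟨ solve 2 (λ s i → (s :+ i) :* (s :+ i) := s :* s :+ (s :+ s :+ i) :* i) refl s i ⟩
    s * s + (s + s + i) * i        ≤⟨ ℚ.+-monoʳ-≤ (s * s) (ℚ.*-monoʳ-≤-nonNeg i {{nonNegative (ℚ.<⇒≤ (0<1/1+n n))}}
                                        (ℚ.+-mono-≤ (ℚ.+-mono-≤ s≤B′ s≤B′) (1/1+-antimono {0} {n} ℕ.z≤n))) ⟩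
    s * s + (B + B + 1ℚ) * i       ∎
    where
    s = √≈ n q
    i = 1/1+ n
    s≤B′ : s ≤ B
    s≤B′ = ℚ.≤-trans (p≤∣p∣ s) s≤B

------------------------------------------------------------------------
-- Real numbers: Cauchy sequences of rationals, with equality _≃_

open Rational

IsCauchy : (ℕ → ℚ) → Set
IsCauchy s = ∀ ε → 0ℚ ℚ.< ε → ∃[ N ] (∀ m n → N ℕ.≤ m → N ℕ.≤ n → ℚ.∣ s m ℚ.- s n ∣ ℚ.≤ ε)

record ℝ : Set where
  constructor mkℝ
  field
    seq    : ℕ → ℚ
    cauchy : IsCauchy seq

open ℝ public

infix  4 _≃_ _≤_
infixl 6 _+_ _-_
infixl 7 _*_
infix  8 -_ √_

_≃_ : Rel ℝ 0ℓ
x ≃ y = ∀ ε → 0ℚ ℚ.< ε → ∃[ N ] (∀ n → N ℕ.≤ n → ℚ.∣ seq x n ℚ.- seq y n ∣ ℚ.≤ ε)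

_≤_ : Rel ℝ 0ℓ
x ≤ y = ∀ ε → 0ℚ ℚ.< ε → ∃[ N ] (∀ n → N ℕ.≤ n → seq x n ℚ.≤ seq y n ℚ.+ ε)

private
  m⊔n≤o⇒m≤o : ∀ m n {o} → m ℕ.⊔ n ℕ.≤ o → m ℕ.≤ o
  m⊔n≤o⇒m≤o m n = ℕ.≤-trans (ℕ.m≤m⊔n m n)

  m⊔n≤o⇒n≤o : ∀ m n {o} → m ℕ.⊔ n ℕ.≤ o → n ℕ.≤ o
  m⊔n≤o⇒n≤o m n = ℕ.≤-trans (ℕ.m≤n⊔m m n)

  open ℚ.≤-Reasoning
  open +-*-Solver using (solve; _:=_; _:+_; :-_; _:-_)

opaque
  const-cauchy : ∀ q → IsCauchy (λ _ → q)
  const-cauchy q ε 0<ε = 0 , λ _ _ _ _ → begin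
    ℚ.∣ q ℚ.- q ∣   ≡⟨ cong ℚ.∣_∣ (ℚ.+-inverseʳ q) ⟩
    0ℚ              ≤⟨ ℚ.<⇒≤ 0<ε ⟩
    ε               ∎

fromℚ : ℚ → ℝ
fromℚ q = mkℝ (λ _ → q) (const-cauchy q)

0ℝ 1ℝ : ℝ
0ℝ = fromℚ 0ℚ
1ℝ = fromℚ 1ℚ

opaque
  +-cauchy : ∀ x y → IsCauchy (λ n → seq x n ℚ.+ seq y n)
  +-cauchy x y ε 0<ε =
    let N₁ , h₁ = cauchy x (ε ℚ.* ½) (half-pos 0<ε)
        N₂ , h₂ = cauchy y (ε ℚ.* ½) (half-pos 0<ε)
    in N₁ ℕ.⊔ N₂ , λ m n N≤m N≤n → begin
      ℚ.∣ seq x m ℚ.+ seq y m ℚ.- (seq x n ℚ.+ seq y n) ∣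
        ≡⟨ cong ℚ.∣_∣ (solve 4 (λ a b c d → a :+ b :- (c :+ d) := a :- c :+ (b :- d)) refl (seq x m) (seq y m) (seq x n) (seq y n)) ⟩
      ℚ.∣ seq x m ℚ.- seq x n ℚ.+ (seq y m ℚ.- seq y n) ∣
        ≤⟨ ℚ.∣p+q∣≤∣p∣+∣q∣ (seq x m ℚ.- seq x n) (seq y m ℚ.- seq y n) ⟩
      ℚ.∣ seq x m ℚ.- seq x n ∣ ℚ.+ ℚ.∣ seq y m ℚ.- seq y n ∣
        ≤⟨ ℚ.+-mono-≤ (h₁ m n (m⊔n≤o⇒m≤o N₁ N₂ N≤m) (m⊔n≤o⇒m≤o N₁ N₂ N≤n))
                      (h₂ m n (m⊔n≤o⇒n≤o N₁ N₂ N≤m) (m⊔n≤o⇒n≤o N₁ N₂ N≤n)) ⟩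
      ε ℚ.* ½ ℚ.+ ε ℚ.* ½
        ≡⟨ halves ε ⟩
      ε ∎

_+_ : ℝ → ℝ → ℝ
x + y = mkℝ (λ n → seq x n ℚ.+ seq y n) (+-cauchy x y)

opaque
  neg-cauchy : ∀ x → IsCauchy (λ n → ℚ.- seq x n)
  neg-cauchy x ε 0<ε =
    let N , h = cauchy x ε 0<ε
    in N , λ m n N≤m N≤n → begin
      ℚ.∣ ℚ.- seq x m ℚ.- ℚ.- seq x n ∣
        ≡⟨ cong ℚ.∣_∣ (solve 2 (λ a b → :- a :- :- b := b :- a) refl (seq x m) (seq x n)) ⟩
      ℚ.∣ seq x n ℚ.- seq x m ∣
        ≤⟨ h n m N≤n N≤m ⟩
      ε ∎

-_ : ℝ → ℝ
- x = mkℝ (λ n → ℚ.- seq x n) (neg-cauchy x)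

_-_ : ℝ → ℝ → ℝ
x - y = x + - y

bounded : ∀ x → ∃[ B ] (0ℚ ℚ.< B × ∃[ N ] (∀ n → N ℕ.≤ n → ℚ.∣ seq x n ∣ ℚ.≤ B))
bounded x =
  let N , h = cauchy x 1ℚ (ℚ.positive⁻¹ 1ℚ)
  in ℚ.∣ seq x N ∣ ℚ.+ 1ℚ , ℚ.+-mono-≤-< (ℚ.0≤∣p∣ (seq x N)) (ℚ.positive⁻¹ 1ℚ) , N , λ n N≤n → begin
    ℚ.∣ seq x n ∣
      ≡⟨ cong ℚ.∣_∣ (solve 2 (λ a b → b := a :+ (b :- a)) refl (seq x N) (seq x n)) ⟩
    ℚ.∣ seq x N ℚ.+ (seq x n ℚ.- seq x N) ∣
      ≤⟨ ℚ.∣p+q∣≤∣p∣+∣q∣ (seq x N) (seq x n ℚ.- seq x N) ⟩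
    ℚ.∣ seq x N ∣ ℚ.+ ℚ.∣ seq x n ℚ.- seq x N ∣
      ≤⟨ ℚ.+-monoʳ-≤ ℚ.∣ seq x N ∣ (h n N N≤n ℕ.≤-refl) ⟩
    ℚ.∣ seq x N ∣ ℚ.+ 1ℚ ∎

opaque
  *-cauchy : ∀ x y → IsCauchy (λ n → seq x n ℚ.* seq y n)
  *-cauchy x y ε 0<ε =
    let A , 0<A , N₁ , a = bounded x
        B , 0<B , N₂ , b = bounded y
        δ , 0<δ , [A+B]δ≡ε = divide 0<ε (ℚ.+-mono-< 0<A 0<B)
        N₃ , c = cauchy x δ 0<δ
        N₄ , d = cauchy y δ 0<δ
        M₁ = N₁ ℕ.⊔ N₂
        M₂ = N₃ ℕ.⊔ N₄
    in M₁ ℕ.⊔ M₂ , λ m n N≤m N≤n →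
      let M₁≤m = m⊔n≤o⇒m≤o M₁ M₂ N≤m
          M₁≤n = m⊔n≤o⇒m≤o M₁ M₂ N≤n
          M₂≤m = m⊔n≤o⇒n≤o M₁ M₂ N≤m
          M₂≤n = m⊔n≤o⇒n≤o M₁ M₂ N≤n
      in ℚ.≤-trans
           (*-diff-bound {seq x m} {seq y m} {seq x n} {seq y n} {A} {B} {δ}
             (a m (m⊔n≤o⇒m≤o N₁ N₂ M₁≤m)) (b n (m⊔n≤o⇒n≤o N₁ N₂ M₁≤n))
             (d m n (m⊔n≤o⇒n≤o N₃ N₄ M₂≤m) (m⊔n≤o⇒n≤o N₃ N₄ M₂≤n))
             (c m n (m⊔n≤o⇒m≤o N₃ N₄ M₂≤m) (m⊔n≤o⇒m≤o N₃ N₄ M₂≤n)))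
           (ℚ.≤-reflexive [A+B]δ≡ε)

_*_ : ℝ → ℝ → ℝ
x * y = mkℝ (λ n → seq x n ℚ.* seq y n) (*-cauchy x y)

opaque
  √-cauchy : ∀ x → IsCauchy (λ n → √≈ n (seq x n))
  √-cauchy x ε 0<ε =
    let δ = ε ℚ.* ½
        0<δ = half-pos 0<ε
        N₁ , h = cauchy x (δ ℚ.* δ) (*-pos 0<δ 0<δ)
        N₂ , 1/1+N₂≤δ = archimedean 0<δ
        half : ∀ m n → N₁ ℕ.⊔ N₂ ℕ.≤ m → N₁ ℕ.⊔ N₂ ℕ.≤ n → √≈ m (seq x m) ℚ.- √≈ n (seq x n) ℚ.≤ ε
        half m n N≤m N≤n = p≤q+r⇒p-q≤r (√≈ m (seq x m)) (√≈ n (seq x n)) (begin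
          √≈ m (seq x m)
            ≤⟨ √≈-close m n {seq x m} {seq x n} {δ} (ℚ.<⇒≤ 0<δ)
                 (ℚ.≤-trans (p≤∣p∣ (seq x m ℚ.- seq x n)) (h m n (m⊔n≤o⇒m≤o N₁ N₂ N≤m) (m⊔n≤o⇒m≤o N₁ N₂ N≤n))) ⟩
          √≈ n (seq x n) ℚ.+ (1/1+ n ℚ.+ δ)
            ≤⟨ ℚ.+-monoʳ-≤ (√≈ n (seq x n)) (ℚ.+-monoˡ-≤ δ (ℚ.≤-trans (1/1+-antimono (m⊔n≤o⇒n≤o N₁ N₂ N≤n)) 1/1+N₂≤δ)) ⟩
          √≈ n (seq x n) ℚ.+ (δ ℚ.+ δ)
            ≡⟨ cong (λ r → √≈ n (seq x n) ℚ.+ r) (halves ε) ⟩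
          √≈ n (seq x n) ℚ.+ ε ∎)
    in N₁ ℕ.⊔ N₂ , λ m n N≤m N≤n →
      ∣∣-intro (half m n N≤m N≤n)
        (subst (ℚ._≤ ε) (sym (-‿swap (√≈ m (seq x m)) (√≈ n (seq x n)))) (half n m N≤n N≤m))

-- The nonnegative square root of x when 0 ≤ x (see 0≤√ and √-square); a
-- total function, with value 0 at negative arguments.
√_ : ℝ → ℝ
√ x = mkℝ (λ n → √≈ n (seq x n)) (√-cauchy x)

0≤√ : ∀ x → 0ℝ ≤ √ x
0≤√ x ε 0<ε = 0 , λ n _ → ℚ.+-mono-≤ (0≤√≈ n (seq x n)) (ℚ.<⇒≤ 0<ε)

√-square : ∀ x → 0ℝ ≤ x → √ x * √ x ≃ x
√-square x 0≤x ε 0<ε = close (bounded (√ x)) (0≤x ε 0<ε)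
  where
  close : ∃[ B ] (0ℚ ℚ.< B × ∃[ N ] (∀ n → N ℕ.≤ n → ℚ.∣ √≈ n (seq x n) ∣ ℚ.≤ B)) →
          ∃[ N ] (∀ n → N ℕ.≤ n → 0ℚ ℚ.≤ seq x n ℚ.+ ε) →
          ∃[ N ] (∀ n → N ℕ.≤ n → ℚ.∣ √≈ n (seq x n) ℚ.* √≈ n (seq x n) ℚ.- seq x n ∣ ℚ.≤ ε)
  close (B , 0<B , N₁ , b) (N₃ , h) = close′ (divide 0<ε 0<C)
    where
    C : ℚ
    C = B ℚ.+ B ℚ.+ 1ℚ
    0<C : 0ℚ ℚ.< C
    0<C = ℚ.+-mono-< (ℚ.+-mono-< 0<B 0<B) (ℚ.positive⁻¹ 1ℚ)
    close″ : ∀ δ N₂ → C ℚ.* δ ≡ ε → 1/1+ N₂ ℚ.≤ δ → ∀ n → N₁ ℕ.≤ n → N₂ ℕ.≤ n → N₃ ℕ.≤ n →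
             ℚ.∣ √≈ n (seq x n) ℚ.* √≈ n (seq x n) ℚ.- seq x n ∣ ℚ.≤ ε
    close″ δ N₂ Cδ≡ε 1/1+N₂≤δ n N₁≤n N₂≤n N₃≤n = ∣∣-intro
      (p≤q+r⇒p-q≤r s² (seq x n) (√≈-square-lower n (ℚ.<⇒≤ 0<ε) (h n N₃≤n)))
      (subst (ℚ._≤ ε) (sym (-‿swap s² (seq x n))) (p≤q+r⇒p-q≤r (seq x n) s² (begin
        seq x n
          ≤⟨ √≈-square-upper n {seq x n} {B} (b n N₁≤n) ⟩
        s² ℚ.+ C ℚ.* 1/1+ n
          ≤⟨ ℚ.+-monoʳ-≤ s² (ℚ.*-monoˡ-≤-nonNeg C {{ℚ.nonNegative (ℚ.<⇒≤ 0<C)}}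
               (ℚ.≤-trans (1/1+-antimono N₂≤n) 1/1+N₂≤δ)) ⟩
        s² ℚ.+ C ℚ.* δ
          ≡⟨ cong (λ r → s² ℚ.+ r) Cδ≡ε ⟩
        s² ℚ.+ ε ∎)))
      where
      s² : ℚ
      s² = √≈ n (seq x n) ℚ.* √≈ n (seq x n)
    close′ : ∃[ δ ] (0ℚ ℚ.< δ × C ℚ.* δ ≡ ε) →
             ∃[ N ] (∀ n → N ℕ.≤ n → ℚ.∣ √≈ n (seq x n) ℚ.* √≈ n (seq x n) ℚ.- seq x n ∣ ℚ.≤ ε)
    close′ (δ , 0<δ , Cδ≡ε) = N₁ ℕ.⊔ N₂ ℕ.⊔ N₃ , λ n N≤n →
      let M≤n = m⊔n≤o⇒m≤o (N₁ ℕ.⊔ N₂) N₃ N≤n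
      in close″ δ N₂ Cδ≡ε (proj₂ (archimedean 0<δ)) n
           (m⊔n≤o⇒m≤o N₁ N₂ M≤n) (m⊔n≤o⇒n≤o N₁ N₂ M≤n) (m⊔n≤o⇒n≤o (N₁ ℕ.⊔ N₂) N₃ N≤n)
      where
      N₂ : ℕ
      N₂ = proj₁ (archimedean 0<δ)

fromNat : ℕ → ℝ
fromNat k = fromℚ (+ k ℚ./ 1)

1/_ : (k : ℕ) → .{{ℕ.NonZero k}} → ℝ
1/ k = fromℚ (+ 1 ℚ./ k)

+-0-rawMonoid : RawMonoid 0ℓ 0ℓ
+-0-rawMonoid = record { Carrier = ℝ ; _≈_ = _≃_ ; _∙_ = _+_ ; ε = 0ℝ }

∑ : ∀ {n} → (Fin n → ℝ) → ℝ
∑ = sum +-0-rawMonoid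

------------------------------------------------------------------------
-- Graphs on the vertex set Fin n

record Graph (n : ℕ) : Set₁ where
  field
    Adj    : Rel (Fin n) 0ℓ
    adj?   : Decidable Adj
    symm   : Symmetric Adj
    irrefl : Irreflexive _≡_ Adj

module _ {n : ℕ} (G : Graph n) where

  open Graph G

  IsClique : Subset n → Set
  IsClique S = ∀ {u v} → u ∈ S → v ∈ S → u ≢ v → Adj u v

  record IsCliqueNumber (ω : ℕ) : Set where
    field
      attained : ∃[ S ] (IsClique S × ∣ S ∣ ≡ ω)
      maximal  : ∀ S → IsClique S → ∣ S ∣ ℕ.≤ ω

  -- Each undirected edge is represented by its ordered pair u < v.
  ∑E : (Fin n → Fin n → ℝ) → ℝ
  ∑E f = ∑ λ u → ∑ λ v → if does (u Fin.<? v ×-dec adj? u v) then f u v else 0ℝ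

cliqueNumber-nonZero : ∀ {n ω} {G : Graph n} → 1 ℕ.≤ n → IsCliqueNumber G ω → ℕ.NonZero ω
cliqueNumber-nonZero {suc n} {ω} _ isω =
  ℕ.>-nonZero (subst (ℕ._≤ ω) (∣⁅x⁆∣≡1 {suc n} Fin.zero) (maximal ⁅ Fin.zero ⁆
    λ u∈ v∈ u≢v → ⊥-elim (u≢v (trans (x∈⁅y⁆⇒x≡y Fin.zero u∈) (sym (x∈⁅y⁆⇒x≡y Fin.zero v∈))))))
  where open IsCliqueNumber isω

------------------------------------------------------------------------
-- Doubly nonnegative matrices

Matrix : ℕ → Set
Matrix n = Fin n → Fin n → ℝ

record DoublyNonnegative {n : ℕ} (M : Matrix n) : Set where
  field
    symmetric            : ∀ u v → M u v ≃ M v u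
    positiveSemidefinite : ∀ (x : Fin n → ℝ) → 0ℝ ≤ ∑ λ u → ∑ λ v → x u * M u v * x v
    nonnegative          : ∀ u v → 0ℝ ≤ M u v

{-# OPTIONS --safe #-}
module Submission where

-- For a vertex set U whose cliques have at most k vertices, weights
-- q(u,v) ∈ (0,1] on the edges of U are defined recursively by averaging over
-- w ∈ U: the contribution of w is 0, 1 or the weight of uv inside U ∩ N(w),
-- according to whether w is adjacent to none, one or both of u and v.  By
-- induction on k these weights satisfy, with sums over ordered adjacent pairs,
--
--   (1)  ∑ q(u,v) M(u,v) ≤ (1 − 1/ω) ∑ M(u,v)  for doubly nonnegative M, since
--        (k − 1) J − k (A ∘ q) is a sum of a positive semidefinite and a
--        nonnegative matrix, and
--   (2)  ∑ 1/q(u,v) ≤ (1 − 1/ω) n².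
--
-- Cauchy–Schwarz applied to √M = √(q M) · √(1/q) then gives the bound.

open import Algebra.Bundles using (module CommutativeRing)
open import Data.Bool.Base using (Bool; true; false; _∧_; if_then_else_)
open import Data.Bool.Properties using (¬-not)
open import Data.Fin.Base as Fin using (Fin)
import Data.Fin.Properties as Fin
open import Data.Fin.Subset using (_∈_; _∪_; ⁅_⁆; ∣_∣; ⊥)
open import Data.Fin.Subset.Properties using (x∈⁅y⁆⇒x≡y; x∈⁅x⁆; x∈p∪q⁻; p⊆p∪q; q⊆p∪q; p⊂q⇒∣p∣<∣q∣; ∉⊥; ∣⊥∣≡0)
open import Data.Nat.Base as ℕ using (ℕ; zero; suc)
import Data.Nat.Properties as ℕ
open import Data.Product.Base using (∃-syntax; _×_; _,_; proj₁; proj₂)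
open import Data.Rational.Base as ℚ using (ℚ; 0ℚ; 1ℚ; ½)
import Data.Rational.Properties as ℚ
open import Data.Rational.Solver using (module +-*-Solver)
open import Data.Sum.Base using (_⊎_; inj₁; inj₂)
open import Function.Bundles using (mk⇔)
open import Relation.Binary.PropositionalEquality using (_≡_; _≢_; refl; sym; trans; cong; cong₂; subst; subst₂)
open import Relation.Nullary.Decidable using (Dec; yes; no; does; does-⇔; dec-false)
open import Relation.Nullary.Negation using (contradiction)
import Defs

-- With all weights 1, (2) is Turán's bound, and (k - 1) J - k A is copositive by Motzkin-Straus.
-- For a doubly nonnegative M that is too weak: for the 5-cycle and k = 2, J - 2A is the Horn
-- matrix, which is not a sum of a positive semidefinite and a nonnegative matrix. So the weights
-- must drop below 1, and (2) limits how far.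
--
-- They come from the random greedy clique that picks w uniformly in U and continues in U ∩ N(w):
-- q(u,v) is the probability that the first pick not adjacent to both ends is adjacent to exactly
-- one. With π(u) the probability that u is itself picked, (2) follows from the local bound 1/π(u) +
-- ∑ 1/q(u,v) ≤ |U|.
--
-- Everything is estimated on rational approximants, a real inequality being read as a nonnegative
-- limit inferior of the difference. The squares in the induction come from rational vectors, so
-- positive semidefiniteness is applied to constant sequences. Cauchy-Schwarz takes the form of
-- AM-GM with a positive rational parameter in place of the root of the total, which may be 0.

module RationalLemmas where

  open import Algebra.Properties.Semiring.Sum (CommutativeRing.semiring ℚ.+-*-commutativeRing) public
    using (sum; sum-cong-≗; ∑-distrib-+; ∑-comm; *-distribˡ-sum; *-distribʳ-sum; sum-replicate-zero)
  open import Data.Rational.Base using (_+_; _*_; _-_; -_; _≤_; _<_)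
  open ℚ.≤-Reasoning
  open +-*-Solver using (solve; _:=_; _:+_; _:*_; :-_; _:-_; con)
  open Defs.Rational

  -- Order lemmas and reciprocals of rationals.

  p≤p+q : ∀ p {q} → 0ℚ ≤ q → p ≤ p + q
  p≤p+q p 0≤q = subst (_≤ p + _) (ℚ.+-identityʳ p) (ℚ.+-monoʳ-≤ p 0≤q)

  ≤-by-gap : ∀ {p q r} → 0ℚ ≤ r → q ≡ p + r → p ≤ q
  ≤-by-gap {p} 0≤r q≡p+r = subst (p ≤_) (sym q≡p+r) (p≤p+q p 0≤r)

  0≤q-p : ∀ {p q} → p ≤ q → 0ℚ ≤ q - p
  0≤q-p {p} {q} p≤q = subst (_≤ q - p) (ℚ.+-inverseʳ p) (ℚ.+-monoˡ-≤ (- p) p≤q)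

  p+q≤r⇒q≤r-p : ∀ p q {r} → p + q ≤ r → q ≤ r - p
  p+q≤r⇒q≤r-p p q {r} h = subst (_≤ r - p) (solve 2 (λ p q → p :+ q :- p := q) refl p q) (ℚ.+-monoˡ-≤ (- p) h)

  *-monoˡ : ∀ {p q r} → 0ℚ ≤ r → p ≤ q → r * p ≤ r * q
  *-monoˡ {r = r} 0≤r = ℚ.*-monoˡ-≤-nonNeg r {{ℚ.nonNegative 0≤r}}

  *-monoʳ : ∀ {p q r} → 0ℚ ≤ r → p ≤ q → p * r ≤ q * r
  *-monoʳ {r = r} 0≤r = ℚ.*-monoʳ-≤-nonNeg r {{ℚ.nonNegative 0≤r}}

  *-cancelˡ : ∀ {p q r} → 0ℚ < r → r * p ≤ r * q → p ≤ q
  *-cancelˡ {r = r} 0<r = ℚ.*-cancelˡ-≤-pos r {{ℚ.positive 0<r}}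

  0≤p² : ∀ p → 0ℚ ≤ p * p
  0≤p² p with ℚ.≤-total 0ℚ p
  ... | inj₁ 0≤p = *-nonNeg 0≤p 0≤p
  ... | inj₂ p≤0 = subst (0ℚ ≤_) (solve 1 (λ p → (:- p) :* (:- p) := p :* p) refl p) (*-nonNeg 0≤-p 0≤-p)
    where 0≤-p = ℚ.neg-antimono-≤ p≤0

  0≤p+p⇒0≤p : ∀ {p} → 0ℚ ≤ p + p → 0ℚ ≤ p
  0≤p+p⇒0≤p {p} h with ℚ.≤-total 0ℚ p
  ... | inj₁ 0≤p = 0≤p
  ... | inj₂ p≤0 = ℚ.≤-trans h (subst (p + p ≤_) (ℚ.+-identityʳ p) (ℚ.+-monoʳ-≤ p p≤0))

  -- The value 0 at 0 makes `q` and `π` total on empty vertex sets and keeps `inv p * p ≤ 1` for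
  -- every nonnegative `p`.
  inv : ℚ → ℚ
  inv p with p ℚ.≟ 0ℚ
  ... | yes _   = 0ℚ
  ... | no p≢0  = (ℚ.1/ p) {{ℚ.≢-nonZero p≢0}}

  *-inv : ∀ {p} → 0ℚ < p → p * inv p ≡ 1ℚ
  *-inv {p} 0<p with p ℚ.≟ 0ℚ
  ... | yes p≡0 = contradiction (sym p≡0) (ℚ.<⇒≢ 0<p)
  ... | no p≢0  = ℚ.*-inverseʳ p {{ℚ.≢-nonZero p≢0}}

  0<inv : ∀ {p} → 0ℚ < p → 0ℚ < inv p
  0<inv {p} 0<p with p ℚ.≟ 0ℚ
  ... | yes p≡0 = contradiction (sym p≡0) (ℚ.<⇒≢ 0<p)
  ... | no p≢0  = ℚ.positive⁻¹ _ {{ℚ.1/pos⇒pos p {{ℚ.positive 0<p}}}}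

  0<p⊎inv≡0 : ∀ {p} → 0ℚ ≤ p → 0ℚ < p ⊎ inv p ≡ 0ℚ
  0<p⊎inv≡0 {p} 0≤p with 0ℚ ℚ.<? p
  ... | yes 0<p = inj₁ 0<p
  ... | no 0≮p  = inj₂ (cong inv (ℚ.≤-antisym (ℚ.≮⇒≥ 0≮p) 0≤p))

  0≤inv : ∀ {p} → 0ℚ ≤ p → 0ℚ ≤ inv p
  0≤inv 0≤p with 0<p⊎inv≡0 0≤p
  ... | inj₁ 0<p = ℚ.<⇒≤ (0<inv 0<p)
  ... | inj₂ e   = ℚ.≤-reflexive (sym e)

  inv-*-≤1 : ∀ {p} → 0ℚ ≤ p → inv p * p ≤ 1ℚ
  inv-*-≤1 {p} 0≤p with 0<p⊎inv≡0 0≤p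
  ... | inj₁ 0<p = ℚ.≤-reflexive (trans (ℚ.*-comm (inv p) p) (*-inv 0<p))
  ... | inj₂ e   = subst (_≤ 1ℚ) (sym (trans (cong (_* p) e) (ℚ.*-zeroˡ p))) (ℚ.nonNegative⁻¹ 1ℚ)

  -- Finite sums and double sums of rationals.

  sum-mono : ∀ {n} {f g : Fin n → ℚ} → (∀ i → f i ≤ g i) → sum f ≤ sum g
  sum-mono {zero}  h = ℚ.≤-refl
  sum-mono {suc n} h = ℚ.+-mono-≤ (h Fin.zero) (sum-mono (λ i → h (Fin.suc i)))

  sum-0 : ∀ {n} {f : Fin n → ℚ} → (∀ i → f i ≡ 0ℚ) → sum f ≡ 0ℚ
  sum-0 {n} h = trans (sum-cong-≗ h) (sum-replicate-zero n)

  0≤sum : ∀ {n} {f : Fin n → ℚ} → (∀ i → 0ℚ ≤ f i) → 0ℚ ≤ sum f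
  0≤sum {n} {f} h = subst (_≤ sum f) (sum-replicate-zero n) (sum-mono h)

  term≤sum : ∀ {n} {f : Fin n → ℚ} → (∀ i → 0ℚ ≤ f i) → ∀ i → f i ≤ sum f
  term≤sum {f = f} h Fin.zero    = p≤p+q (f Fin.zero) (0≤sum (λ i → h (Fin.suc i)))
  term≤sum {f = f} h (Fin.suc i) = ℚ.≤-trans (term≤sum (λ i → h (Fin.suc i)) i)
    (subst (_≤ sum f) (ℚ.+-identityˡ (sum (λ i → f (Fin.suc i)))) (ℚ.+-monoˡ-≤ (sum (λ i → f (Fin.suc i))) (h Fin.zero)))

  sum-- : ∀ {n} (f g : Fin n → ℚ) → sum (λ i → f i - g i) ≡ sum f - sum g
  sum-- f g = trans (∑-distrib-+ f (λ i → - g i)) (cong (sum f +_) (begin-equality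
    sum (λ i → - g i)        ≡⟨ sum-cong-≗ (λ i → -p≡-1*p (g i)) ⟩
    sum (λ i → - 1ℚ * g i)   ≡⟨ *-distribˡ-sum (- 1ℚ) g ⟨
    - 1ℚ * sum g             ≡⟨ -p≡-1*p (sum g) ⟨
    - sum g                  ∎))
    where
    -p≡-1*p : ∀ p → - p ≡ - 1ℚ * p
    -p≡-1*p = solve 1 (λ p → :- p := con (- 1ℚ) :* p) refl

  sum-const : ∀ n c → sum {n} (λ _ → c) ≡ fromℕ n * c
  sum-const zero    c = sym (ℚ.*-zeroˡ c)
  sum-const (suc n) c = begin-equality
    c + sum {n} (λ _ → c)   ≡⟨ cong (c +_) (sum-const n c) ⟩
    c + fromℕ n * c         ≡⟨ solve 2 (λ c n → c :+ n :* c := (n :+ con 1ℚ) :* c) refl c (fromℕ n) ⟩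
    (fromℕ n + 1ℚ) * c      ≡⟨ cong (_* c) (fromℕ-suc n) ⟨
    fromℕ (suc n) * c       ∎

  sum²-* : ∀ {n} c (f : Fin n → Fin n → ℚ) → sum (λ i → sum (λ j → c * f i j)) ≡ c * sum (λ i → sum (λ j → f i j))
  sum²-* c f = sym (trans (*-distribˡ-sum c (λ i → sum (f i))) (sum-cong-≗ (λ i → *-distribˡ-sum c (f i))))

  sum²-+ : ∀ {n} (f g : Fin n → Fin n → ℚ) →
           sum (λ i → sum (λ j → f i j + g i j)) ≡ sum (λ i → sum (λ j → f i j)) + sum (λ i → sum (λ j → g i j))
  sum²-+ f g = trans (sum-cong-≗ (λ i → ∑-distrib-+ (f i) (g i))) (∑-distrib-+ (λ i → sum (f i)) (λ i → sum (g i)))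

  sum²-- : ∀ {n} (f g : Fin n → Fin n → ℚ) →
           sum (λ i → sum (λ j → f i j - g i j)) ≡ sum (λ i → sum (λ j → f i j)) - sum (λ i → sum (λ j → g i j))
  sum²-- f g = trans (sum-cong-≗ (λ i → sum-- (f i) (g i))) (sum-- (λ i → sum (f i)) (λ i → sum (g i)))

  sum²-mono : ∀ {n} {f g : Fin n → Fin n → ℚ} → (∀ i j → f i j ≤ g i j) →
              sum (λ i → sum (λ j → f i j)) ≤ sum (λ i → sum (λ j → g i j))
  sum²-mono h = sum-mono λ i → sum-mono (h i)

  sum²-symmetrise : ∀ {n} (f : Fin n → Fin n → ℚ) → (∀ i j → 0ℚ ≤ f i j + f j i) →
                    0ℚ ≤ sum (λ i → sum (λ j → f i j))
  sum²-symmetrise f h = 0≤p+p⇒0≤p (subst (0ℚ ≤_)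
    (trans (sum²-+ f (λ i j → f j i)) (cong (sum (λ i → sum (f i)) +_) (sym (∑-comm f))))
    (0≤sum (λ i → 0≤sum (h i))))

  -- The inequality for two adjacent neighbours of a vertex.

  2ℚ : ℚ
  2ℚ = 1ℚ + 1ℚ

  -- In `sum-inv-q≤`, with a = `G i`, b = `G l`, x = `x l i`, y = `x i l`, this is
  -- `t i l - G i * G l` plus its mirror image, for i and l adjacent.
  pair-gap : (a b x y : ℚ) → ℚ
  pair-gap a b x y = (a - b) * (a - b) + a * a * inv y + b * b * inv x - (a * a * (2ℚ - x) + b * b * (2ℚ - y))

  -- The larger of a and b supplies the AM-GM term, and the other reciprocal
  -- only needs y ≤ 1.
  0≤pair-gap-ordered : ∀ {a b x y} → 0ℚ ≤ b → b ≤ a → 0ℚ < x → 0ℚ < y → y ≤ 1ℚ → 0ℚ ≤ pair-gap a b x y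
  0≤pair-gap-ordered {a} {b} {x} {y} 0≤b b≤a 0<x 0<y y≤1 = subst (0ℚ ≤_) (sym eq)
    (ℚ.+-mono-≤ (*-nonNeg (ℚ.<⇒≤ (0<inv 0<x)) (0≤p² (b - a * x)))
                (*-nonNeg (*-nonNeg (0≤q-p y≤1) (ℚ.<⇒≤ (0<inv 0<y)))
                  (0≤q-p (ℚ.≤-trans (subst (y * (b * b) ≤_) (ℚ.*-identityˡ (b * b)) (*-monoʳ (0≤p² b) y≤1))
                                    (square-mono-≤ 0≤b b≤a)))))
    where
    X = inv x
    Y = inv y
    eq : pair-gap a b x y ≡ X * ((b - a * x) * (b - a * x)) + (1ℚ - y) * Y * (a * a - y * (b * b))
    eq = begin-equality
      pair-gap a b x y
        -- The solver sees X and Y as free variables, so the identity carries explicit multiples of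
        -- `1ℚ - x * X` and `1ℚ - y * Y`, which are then shown to vanish.
        ≡⟨ solve 6 (λ a b x y X Y →
             (a :- b) :* (a :- b) :+ a :* a :* Y :+ b :* b :* X :- (a :* a :* (con 2ℚ :- x) :+ b :* b :* (con 2ℚ :- y))
             := X :* ((b :- a :* x) :* (b :- a :* x)) :+ (con 1ℚ :- y) :* Y :* (a :* a :- y :* (b :* b))
                :+ ((con 1ℚ :- x :* X) :* (a :* a :* x :- con 2ℚ :* a :* b)
                    :+ (con 1ℚ :- y :* Y) :* (y :* b :* b :- a :* a :- b :* b)))
             refl a b x y X Y ⟩
      main + ((1ℚ - x * X) * r + (1ℚ - y * Y) * s)
        ≡⟨ cong₂ (λ c d → main + ((1ℚ - c) * r + (1ℚ - d) * s)) (*-inv 0<x) (*-inv 0<y) ⟩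
      main + ((1ℚ - 1ℚ) * r + (1ℚ - 1ℚ) * s)
        ≡⟨ solve 3 (λ m r s → m :+ ((con 1ℚ :- con 1ℚ) :* r :+ (con 1ℚ :- con 1ℚ) :* s) := m) refl main r s ⟩
      main ∎
      where
      main = X * ((b - a * x) * (b - a * x)) + (1ℚ - y) * Y * (a * a - y * (b * b))
      r = a * a * x - 2ℚ * a * b
      s = y * b * b - a * a - b * b

  0≤pair-gap : ∀ {a b x y} → 0ℚ ≤ a → 0ℚ ≤ b → 0ℚ < x → x ≤ 1ℚ → 0ℚ < y → y ≤ 1ℚ → 0ℚ ≤ pair-gap a b x y
  0≤pair-gap {a} {b} {x} {y} 0≤a 0≤b 0<x x≤1 0<y y≤1 with ℚ.≤-total b a
  ... | inj₁ b≤a = 0≤pair-gap-ordered 0≤b b≤a 0<x 0<y y≤1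
  ... | inj₂ a≤b = subst (0ℚ ≤_)
    (solve 6 (λ a b x y X Y →
       (b :- a) :* (b :- a) :+ b :* b :* X :+ a :* a :* Y :- (b :* b :* (con 2ℚ :- y) :+ a :* a :* (con 2ℚ :- x))
       := (a :- b) :* (a :- b) :+ a :* a :* Y :+ b :* b :* X :- (a :* a :* (con 2ℚ :- x) :+ b :* b :* (con 2ℚ :- y)))
       refl a b x y (inv x) (inv y))
    (0≤pair-gap-ordered 0≤a a≤b 0<y 0<x x≤1)

module Indicators where

  open import Data.Rational.Base using (_*_; _≤_)
  open RationalLemmas

  ⟦_⟧ : Bool → ℚ
  ⟦ true ⟧  = 1ℚ
  ⟦ false ⟧ = 0ℚ

  ⟦∧⟧ : ∀ b c → ⟦ b ∧ c ⟧ ≡ ⟦ b ⟧ * ⟦ c ⟧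
  ⟦∧⟧ true  c = sym (ℚ.*-identityˡ ⟦ c ⟧)
  ⟦∧⟧ false c = sym (ℚ.*-zeroˡ ⟦ c ⟧)

  0≤⟦_⟧ : ∀ b → 0ℚ ≤ ⟦ b ⟧
  0≤⟦ true ⟧  = ℚ.nonNegative⁻¹ 1ℚ
  0≤⟦ false ⟧ = ℚ.≤-refl

  ⟦⟧-mono : ∀ b {p q} → (b ≡ true → p ≤ q) → ⟦ b ⟧ * p ≤ ⟦ b ⟧ * q
  ⟦⟧-mono true          h = *-monoˡ (ℚ.nonNegative⁻¹ 1ℚ) (h refl)
  ⟦⟧-mono false {p} {q} h = ℚ.≤-reflexive (trans (ℚ.*-zeroˡ p) (sym (ℚ.*-zeroˡ q)))

  0≤⟦⟧* : ∀ b {p} → (b ≡ true → 0ℚ ≤ p) → 0ℚ ≤ ⟦ b ⟧ * p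
  0≤⟦⟧* b {p} h = subst (_≤ ⟦ b ⟧ * p) (ℚ.*-zeroʳ ⟦ b ⟧) (⟦⟧-mono b h)

  ∧-true : ∀ {b c} → b ≡ true → c ≡ true → b ∧ c ≡ true
  ∧-true refl refl = refl

  ∧-trueˡ : ∀ b {c} → b ∧ c ≡ true → b ≡ true
  ∧-trueˡ true _ = refl

  ∧-trueʳ : ∀ b {c} → b ∧ c ≡ true → c ≡ true
  ∧-trueʳ true h = h

-- Inequalities between rational sequences up to vanishing error.

module Asymptotics where

  open import Data.Rational.Base using (_+_; _*_; _-_; _≤_; _<_)
  open ℚ.≤-Reasoning
  open +-*-Solver using (solve; _:=_; _:+_; _:*_; _:-_; con)
  open Defs.Rational
  open RationalLemmas

  -- The limit inferior of f is nonnegative.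
  record 0≲_ (f : ℕ → ℚ) : Set where
    constructor 0≲-intro
    field
      eventually : ∀ ε → 0ℚ < ε → ∃[ N ] (∀ m → N ℕ.≤ m → 0ℚ ≤ f m + ε)

  open 0≲_ public

  0≲-mono : ∀ {f g} → (∀ m → f m ≤ g m) → 0≲ f → 0≲ g
  0≲-mono f≤g 0≲f = 0≲-intro λ ε 0<ε → let K , h = eventually 0≲f ε 0<ε in
    K , λ m K≤m → ℚ.≤-trans (h m K≤m) (ℚ.+-monoˡ-≤ ε (f≤g m))

  0≲-cong : ∀ {f g} → (∀ m → f m ≡ g m) → 0≲ f → 0≲ g
  0≲-cong f≡g = 0≲-mono λ m → ℚ.≤-reflexive (f≡g m)

  0≤⇒0≲ : ∀ {f} → (∀ m → 0ℚ ≤ f m) → 0≲ f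
  0≤⇒0≲ {f} 0≤f = 0≲-intro λ ε 0<ε → 0 , λ m _ → ℚ.≤-trans (0≤f m) (p≤p+q (f m) (ℚ.<⇒≤ 0<ε))

  0≲-+ : ∀ {f g} → 0≲ f → 0≲ g → 0≲ (λ m → f m + g m)
  0≲-+ {f} {g} 0≲f 0≲g = 0≲-intro λ ε 0<ε →
    let K , h = eventually 0≲f (ε * ½) (half-pos 0<ε)
        L , k = eventually 0≲g (ε * ½) (half-pos 0<ε)
    in K ℕ.⊔ L , λ m K⊔L≤m → begin
      0ℚ                               ≤⟨ ℚ.+-mono-≤ (h m (ℕ.≤-trans (ℕ.m≤m⊔n K L) K⊔L≤m)) (k m (ℕ.≤-trans (ℕ.m≤n⊔m K L) K⊔L≤m)) ⟩
      f m + ε * ½ + (g m + ε * ½)      ≡⟨ solve 3 (λ a b e → a :+ e :+ (b :+ e) := a :+ b :+ (e :+ e)) refl (f m) (g m) (ε * ½) ⟩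
      f m + g m + (ε * ½ + ε * ½)      ≡⟨ cong (f m + g m +_) (halves ε) ⟩
      f m + g m + ε                    ∎

  0≲-* : ∀ {f} c → 0ℚ ≤ c → 0≲ f → 0≲ (λ m → c * f m)
  0≲-* {f} c 0≤c 0≲f = 0≲-intro λ ε 0<ε →
    let δ , 0<δ , [c+1]δ≡ε = divide {ε} {c + 1ℚ} 0<ε (ℚ.+-mono-≤-< 0≤c (ℚ.positive⁻¹ 1ℚ))
        K , h = eventually 0≲f δ 0<δ
    in K , λ m K≤m → begin
      0ℚ                       ≤⟨ *-nonNeg 0≤c (h m K≤m) ⟩
      c * (f m + δ)            ≤⟨ ≤-by-gap (ℚ.<⇒≤ 0<δ) (solve 3 (λ c f d → c :* f :+ (c :+ con 1ℚ) :* d := c :* (f :+ d) :+ d) refl c (f m) δ) ⟩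
      c * f m + (c + 1ℚ) * δ   ≡⟨ cong (c * f m +_) [c+1]δ≡ε ⟩
      c * f m + ε              ∎

  0≲-sum : ∀ {k} {f : Fin k → ℕ → ℚ} → (∀ i → 0≲ f i) → 0≲ (λ m → sum λ i → f i m)
  0≲-sum {zero}  h = 0≤⇒0≲ λ _ → ℚ.≤-refl
  0≲-sum {suc k} h = 0≲-+ (h Fin.zero) (0≲-sum λ i → h (Fin.suc i))

  0≲-sum² : ∀ {n} {f : Fin n → Fin n → ℕ → ℚ} → (∀ i j → 0≲ f i j) → 0≲ (λ m → sum λ i → sum λ j → f i j m)
  0≲-sum² h = 0≲-sum λ i → 0≲-sum (h i)

  0≲-sum²-symmetrise : ∀ {n} (f : Fin n → Fin n → ℕ → ℚ) → (∀ i j → 0≲ (λ m → f i j m + f j i m)) →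
                       0≲ (λ m → sum λ i → sum λ j → f i j m)
  0≲-sum²-symmetrise f h = 0≲-cong
    (λ m → let F = sum λ i → sum λ j → f i j m in begin-equality
      ½ * sum (λ i → sum λ j → f i j m + f j i m)
        ≡⟨ cong (½ *_) (sum²-+ (λ i j → f i j m) (λ i j → f j i m)) ⟩
      ½ * (F + sum (λ i → sum λ j → f j i m))
        ≡⟨ cong (λ z → ½ * (F + z)) (∑-comm (λ i j → f i j m)) ⟨
      ½ * (F + F)
        ≡⟨ solve 1 (λ x → con ½ :* (x :+ x) := x) refl F ⟩
      F ∎)
    (0≲-* ½ (ℚ.nonNegative⁻¹ ½) (0≲-sum² h))

  √≈-square-0≲ : ∀ {f} → 0≲ f → 0≲ (λ m → f m - √≈ m (f m) * √≈ m (f m))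
  √≈-square-0≲ {f} 0≲f = 0≲-intro λ ε 0<ε → let K , h = eventually 0≲f ε 0<ε in K , λ m K≤m →
    subst (0ℚ ≤_) (solve 3 (λ f e s → f :+ e :- s := f :- s :+ e) refl (f m) ε (√≈ m (f m) * √≈ m (f m)))
      (0≤q-p (√≈-square-lower m {f m} {ε} (ℚ.<⇒≤ 0<ε) (h m K≤m)))

  -- Uniform continuity of the root: an excess of at most δ² in the argument raises the approximate
  -- root by at most δ plus the grid width 1/(m + 1), and both are eventually at most ε/2.
  √≈-mono-0≲ : ∀ {f g : ℕ → ℚ} → 0≲ (λ m → g m - f m) → 0≲ (λ m → √≈ m (g m) - √≈ m (f m))
  √≈-mono-0≲ {f} {g} f≲g = 0≲-intro λ ε 0<ε →
    let δ = ε * ½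
        0<δ = half-pos 0<ε
        K , h = eventually f≲g (δ * δ) (*-pos 0<δ 0<δ)
        L , 1/1+L≤δ = archimedean 0<δ
    in K ℕ.⊔ L , λ m K⊔L≤m → subst (0ℚ ≤_)
      (trans (solve 3 (λ g d f → g :+ (d :+ d) :- f := g :- f :+ (d :+ d)) refl (√≈ m (g m)) δ (√≈ m (f m)))
             (cong (√≈ m (g m) - √≈ m (f m) +_) (halves ε)))
      (0≤q-p (ℚ.≤-trans
        (√≈-close m m {f m} {g m} {δ} (ℚ.<⇒≤ 0<δ)
          (≤-by-gap {f m - g m} (h m (ℕ.≤-trans (ℕ.m≤m⊔n K L) K⊔L≤m))
            (solve 3 (λ f g d → d := f :- g :+ (g :- f :+ d)) refl (f m) (g m) (δ * δ))))
        (ℚ.+-monoʳ-≤ (√≈ m (g m)) (ℚ.+-monoˡ-≤ δ (ℚ.≤-trans (1/1+-antimono (ℕ.≤-trans (ℕ.m≤n⊔m K L) K⊔L≤m)) 1/1+L≤δ)))))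

-- The recursive edge weights, their range, and the bound on the sum of their reciprocals.

module EdgeWeights {n : ℕ} (A : Fin n → Fin n → Bool)
                   (A-sym : ∀ u v → A u v ≡ A v u) (A-irrefl : ∀ u → A u u ≡ false) where

  open import Data.Rational.Base using (_+_; _*_; _-_; _≤_; _<_)
  open ℚ.≤-Reasoning
  open +-*-Solver using (solve; _:=_; _:+_; _:*_; _:-_; con)
  open Defs.Rational
  open RationalLemmas
  open Indicators
  open Asymptotics

  VertexSet : Set
  VertexSet = Fin n → Bool

  N : VertexSet → Fin n → VertexSet
  N U w x = U x ∧ A w x

  card : VertexSet → ℚ
  card U = sum λ x → ⟦ U x ⟧

  -- No clique inside U has more than k vertices.
  Free : ℕ → VertexSet → Set
  Free zero    U = ∀ x → U x ≡ false
  Free (suc k) U = ∀ w → U w ≡ true → Free k (N U w)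

  A-true : ∀ {u v} → A u v ≡ true → A v u ≡ true
  A-true {u} {v} = trans (A-sym v u)

  ∈N : ∀ {U w x} → U x ≡ true → A x w ≡ true → N U w x ≡ true
  ∈N {U} {w} {x} Ux Axw = ∧-true Ux (A-true {x} Axw)

  ⟦N⟧ : ∀ U w x → ⟦ N U w x ⟧ ≡ ⟦ U x ⟧ * ⟦ A w x ⟧
  ⟦N⟧ U w x = ⟦∧⟧ (U x) (A w x)

  -- φ is 0, 1 or q according to whether w is adjacent to none, one or both
  -- endpoints.
  φ : (a b q : ℚ) → ℚ
  φ a b q = a + b - a * b * (2ℚ - q)

  -- The value at k = 0 is irrelevant, as Free 0 U makes U empty.
  q : ℕ → VertexSet → Fin n → Fin n → ℚ
  q zero    U u v = 1ℚ
  q (suc k) U u v = inv (card U) * sum λ w → ⟦ U w ⟧ * φ ⟦ A u w ⟧ ⟦ A v w ⟧ (q k (N U w) u v)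

  -- The probability that the random greedy clique in U picks u: either at once, or after a first
  -- pick i adjacent to u, inside N(i).
  π : ℕ → VertexSet → Fin n → ℚ
  π zero    U u = 0ℚ
  π (suc k) U u = inv (card U) * (1ℚ + sum λ i → ⟦ N U u i ⟧ * π k (N U i) u)

  0≤card : ∀ U → 0ℚ ≤ card U
  0≤card U = 0≤sum λ x → 0≤⟦ U x ⟧

  0<card : ∀ U {u} → U u ≡ true → 0ℚ < card U
  0<card U {u} Uu = ℚ.<-≤-trans (ℚ.positive⁻¹ 1ℚ)
    (subst (λ b → ⟦ b ⟧ ≤ card U) Uu (term≤sum (λ x → 0≤⟦ U x ⟧) u))

  φ-bounds : ∀ b c {q} → (b ≡ true → c ≡ true → 0ℚ < q × q ≤ 1ℚ) →
             0ℚ ≤ φ ⟦ b ⟧ ⟦ c ⟧ q × φ ⟦ b ⟧ ⟦ c ⟧ q ≤ 1ℚ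
  φ-bounds true  true  {q} h = subst (λ p → 0ℚ ≤ p × p ≤ 1ℚ)
    (solve 1 (λ q → q := con 1ℚ :+ con 1ℚ :- con 1ℚ :* con 1ℚ :* (con 2ℚ :- q)) refl q)
    (ℚ.<⇒≤ (proj₁ (h refl refl)) , proj₂ (h refl refl))
  φ-bounds true  false {q} h = subst (λ p → 0ℚ ≤ p × p ≤ 1ℚ)
    (solve 1 (λ q → con 1ℚ := con 1ℚ :+ con 0ℚ :- con 1ℚ :* con 0ℚ :* (con 2ℚ :- q)) refl q)
    (ℚ.nonNegative⁻¹ 1ℚ , ℚ.≤-refl)
  φ-bounds false true  {q} h = subst (λ p → 0ℚ ≤ p × p ≤ 1ℚ)
    (solve 1 (λ q → con 1ℚ := con 0ℚ :+ con 1ℚ :- con 0ℚ :* con 1ℚ :* (con 2ℚ :- q)) refl q)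
    (ℚ.nonNegative⁻¹ 1ℚ , ℚ.≤-refl)
  φ-bounds false false {q} h = subst (λ p → 0ℚ ≤ p × p ≤ 1ℚ)
    (solve 1 (λ q → con 0ℚ := con 0ℚ :+ con 0ℚ :- con 0ℚ :* con 0ℚ :* (con 2ℚ :- q)) refl q)
    (ℚ.≤-refl , ℚ.nonNegative⁻¹ 1ℚ)

  q-bounds : ∀ k {U u v} → Free k U → U u ≡ true → U v ≡ true → A u v ≡ true →
             0ℚ < q k U u v × q k U u v ≤ 1ℚ
  q-bounds zero    {U} {u} {v} free Uu Uv Auv = contradiction (trans (sym Uu) (free u)) λ ()
  q-bounds (suc k) {U} {u} {v} free Uu Uv Auv = 0<q , q≤1
    where
    term : Fin n → ℚ
    term w = ⟦ U w ⟧ * φ ⟦ A u w ⟧ ⟦ A v w ⟧ (q k (N U w) u v)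
    bounds : ∀ w → U w ≡ true → 0ℚ ≤ φ ⟦ A u w ⟧ ⟦ A v w ⟧ (q k (N U w) u v) × φ ⟦ A u w ⟧ ⟦ A v w ⟧ (q k (N U w) u v) ≤ 1ℚ
    bounds w Uw = φ-bounds (A u w) (A v w) λ Auw Avw → q-bounds k (free w Uw) (∈N {U} Uu Auw) (∈N {U} Uv Avw) Auv
    0≤term : ∀ w → 0ℚ ≤ term w
    0≤term w = 0≤⟦⟧* (U w) λ Uw → proj₁ (bounds w Uw)
    -- Positivity comes from the term w = u: u is adjacent to v but not to itself, so it contributes
    -- 1.
    term-u : term u ≡ 1ℚ
    term-u rewrite Uu | A-irrefl u | A-true {u} Auv =
      solve 1 (λ q → con 1ℚ :* (con 0ℚ :+ con 1ℚ :- con 0ℚ :* con 1ℚ :* (con 2ℚ :- q)) := con 1ℚ) refl (q k (N U u) u v)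
    0<q : 0ℚ < q (suc k) U u v
    0<q = *-pos (0<inv (0<card U Uu))
      (ℚ.<-≤-trans (ℚ.positive⁻¹ 1ℚ) (subst (_≤ sum term) term-u (term≤sum 0≤term u)))
    q≤1 : q (suc k) U u v ≤ 1ℚ
    q≤1 = begin
      inv (card U) * sum term   ≤⟨ *-monoˡ (0≤inv (0≤card U)) (sum-mono λ w → ℚ.≤-trans
                                     (⟦⟧-mono (U w) λ Uw → proj₂ (bounds w Uw)) (ℚ.≤-reflexive (ℚ.*-identityʳ ⟦ U w ⟧))) ⟩
      inv (card U) * card U     ≤⟨ inv-*-≤1 (0≤card U) ⟩
      1ℚ                        ∎

  -- The sum is the expected size of the random clique. Exchanging u with its neighbour i as outer
  -- index turns the recursive part into sums of the same kind over the sets N(i), to which the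
  -- induction hypothesis applies.
  sum-π≤ : ∀ k U → Free k U → sum (λ u → ⟦ U u ⟧ * π k U u) ≤ fromℕ k
  sum-π≤ zero    U free = ℚ.≤-reflexive (sum-0 λ u → ℚ.*-zeroʳ ⟦ U u ⟧)
  sum-π≤ (suc k) U free = begin
    sum (λ u → ⟦ U u ⟧ * (I * (1ℚ + T u)))
      ≡⟨ sum-cong-≗ (λ u → solve 3 (λ p i t → p :* (i :* (con 1ℚ :+ t)) := i :* (p :+ p :* t)) refl ⟦ U u ⟧ I (T u)) ⟩
    sum (λ u → I * (⟦ U u ⟧ + ⟦ U u ⟧ * T u))
      ≡⟨ *-distribˡ-sum I (λ u → ⟦ U u ⟧ + ⟦ U u ⟧ * T u) ⟨
    I * sum (λ u → ⟦ U u ⟧ + ⟦ U u ⟧ * T u)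
      ≡⟨ cong (I *_) (∑-distrib-+ (λ u → ⟦ U u ⟧) (λ u → ⟦ U u ⟧ * T u)) ⟩
    I * (card U + sum (λ u → ⟦ U u ⟧ * T u))
      ≡⟨ cong (λ s → I * (card U + s)) swapped ⟩
    I * (card U + sum (λ i → ⟦ U i ⟧ * sum (λ u → ⟦ N U i u ⟧ * π k (N U i) u)))
      ≤⟨ *-monoˡ (0≤inv (0≤card U)) (ℚ.+-monoʳ-≤ (card U) (sum-mono λ i → ⟦⟧-mono (U i) λ Ui → sum-π≤ k (N U i) (free i Ui))) ⟩
    I * (card U + sum (λ i → ⟦ U i ⟧ * fromℕ k))
      ≡⟨ cong (λ s → I * (card U + s)) (*-distribʳ-sum (fromℕ k) (λ i → ⟦ U i ⟧)) ⟨
    I * (card U + card U * fromℕ k)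
      ≡⟨ solve 3 (λ i c k → i :* (c :+ c :* k) := i :* c :* (k :+ con 1ℚ)) refl I (card U) (fromℕ k) ⟩
    I * card U * (fromℕ k + 1ℚ)
      ≤⟨ *-monoʳ (ℚ.+-mono-≤ (0≤fromℕ k) (ℚ.nonNegative⁻¹ 1ℚ)) (inv-*-≤1 (0≤card U)) ⟩
    1ℚ * (fromℕ k + 1ℚ)
      ≡⟨ trans (ℚ.*-identityˡ (fromℕ k + 1ℚ)) (sym (fromℕ-suc k)) ⟩
    fromℕ (suc k) ∎
    where
    I = inv (card U)
    T : Fin n → ℚ
    T u = sum λ i → ⟦ N U u i ⟧ * π k (N U i) u
    entry : ∀ u i → ⟦ U u ⟧ * (⟦ N U u i ⟧ * π k (N U i) u) ≡ ⟦ U i ⟧ * (⟦ N U i u ⟧ * π k (N U i) u)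
    entry u i rewrite ⟦N⟧ U u i | ⟦N⟧ U i u | A-sym u i =
      solve 4 (λ p r a x → p :* (r :* a :* x) := r :* (p :* a :* x)) refl ⟦ U u ⟧ ⟦ U i ⟧ ⟦ A i u ⟧ (π k (N U i) u)
    swapped : sum (λ u → ⟦ U u ⟧ * T u) ≡ sum (λ i → ⟦ U i ⟧ * sum (λ u → ⟦ N U i u ⟧ * π k (N U i) u))
    swapped = begin-equality
      sum (λ u → ⟦ U u ⟧ * T u)
        ≡⟨ sum-cong-≗ (λ u → *-distribˡ-sum ⟦ U u ⟧ (λ i → ⟦ N U u i ⟧ * π k (N U i) u)) ⟩
      sum (λ u → sum λ i → ⟦ U u ⟧ * (⟦ N U u i ⟧ * π k (N U i) u))
        ≡⟨ sum-cong-≗ (λ u → sum-cong-≗ (entry u)) ⟩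
      sum (λ u → sum λ i → ⟦ U i ⟧ * (⟦ N U i u ⟧ * π k (N U i) u))
        ≡⟨ ∑-comm (λ u i → ⟦ U i ⟧ * (⟦ N U i u ⟧ * π k (N U i) u)) ⟩
      sum (λ i → sum λ u → ⟦ U i ⟧ * (⟦ N U i u ⟧ * π k (N U i) u))
        ≡⟨ sum-cong-≗ (λ i → *-distribˡ-sum ⟦ U i ⟧ (λ u → ⟦ N U i u ⟧ * π k (N U i) u)) ⟨
      sum (λ i → ⟦ U i ⟧ * sum (λ u → ⟦ N U i u ⟧ * π k (N U i) u)) ∎

  -- The parameter θ linearises the bound card U − ∑ 1/q ≥ 1/π, so that the
  -- induction hypothesis can be rescaled by 1/q before it is summed.
  sum-inv-q≤ : ∀ k U u → Free k U → U u ≡ true → ∀ θ →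
               2ℚ * θ - θ * θ * π k U u + sum (λ l → ⟦ N U u l ⟧ * inv (q k U u l)) ≤ card U
  sum-inv-q≤ zero    U u free Uu θ = contradiction (trans (sym Uu) (free u)) λ ()
  sum-inv-q≤ (suc k) U u free Uu θ = *-cancelˡ 0<c (begin
    c * (2ℚ * θ - θ * θ * (I * (1ℚ + T)) + S)
      ≡⟨ solve 5 (λ c I t T S → c :* (con 2ℚ :* t :- t :* t :* (I :* (con 1ℚ :+ T)) :+ S)
                := c :* (con 2ℚ :* t :+ S) :- t :* t :* (c :* I :* (con 1ℚ :+ T))) refl c I θ T S ⟩
    c * (2ℚ * θ + S) - θ * θ * (c * I * (1ℚ + T))
      ≡⟨ cong (λ z → c * (2ℚ * θ + S) - θ * θ * (z * (1ℚ + T))) (*-inv 0<c) ⟩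
    c * (2ℚ * θ + S) - θ * θ * (1ℚ * (1ℚ + T))
      -- What `total` does not account for in the gap to c² is exactly (c - S - θ)².
      ≤⟨ ≤-by-gap (ℚ.+-mono-≤ (0≤p² (c - S - θ)) (0≤q-p total))
           (solve 4 (λ c t S T → c :* c
              := c :* (con 2ℚ :* t :+ S) :- t :* t :* (con 1ℚ :* (con 1ℚ :+ T))
                 :+ ((c :- S :- t) :* (c :- S :- t) :+ (c :* S :- (con 2ℚ :* t :* S :- t :* t :* T :+ S :* S))))
              refl c θ S T) ⟩
    c * c ∎)
    where
    c = card U
    0<c = 0<card U Uu
    I = inv c
    μ Q G P : Fin n → ℚ
    μ l = ⟦ N U u l ⟧
    Q l = q (suc k) U u l
    G l = inv (Q l)
    P i = π k (N U i) u
    x t f : Fin n → Fin n → ℚ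
    x i l = q k (N U i) u l
    -- Apart from the factor `G i * G i`, this collects what l contributes through the induction
    -- hypothesis in N(i) (the reciprocal of `x i l`) and through the correction term of `c*Q`.
    t i l = G i * G i + ⟦ A i l ⟧ * (G i * G i * inv (x i l) - G i * G i * (2ℚ - x l i))
    f i l = μ i * (μ l * (t i l - G i * G l))
    S = sum λ l → μ l * G l
    T = sum λ i → μ i * P i

    module Neighbour {i} (Ni : N U u i ≡ true) where
      Ui : U i ≡ true
      Ui = ∧-trueˡ (U i) Ni
      Aui : A u i ≡ true
      Aui = ∧-trueʳ (U i) Ni
      0<Q : 0ℚ < Q i
      0<Q = proj₁ (q-bounds (suc k) {U} free Uu Ui Aui)
      0≤G : 0ℚ ≤ G i
      0≤G = ℚ.<⇒≤ (0<inv 0<Q)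
      Nu : N U i u ≡ true
      Nu = ∈N {U} Uu Aui

    x-bounds : ∀ {i l} → N U u i ≡ true → N U u l ≡ true → A i l ≡ true → 0ℚ < x i l × x i l ≤ 1ℚ
    x-bounds {i} {l} Ni Nl Ail = q-bounds k (free i (Ui Ni)) (Nu Ni) (∧-true (Ui Nl) Ail) (Aui Nl)
      where open Neighbour

    -- `φ` splits as b + a (1 - b (2 - y)): the first term counts N(i), the set of the induction
    -- hypothesis, and the second is a correction running over the neighbours of u.
    c*Q : ∀ i → c * Q i ≡ card (N U i) + sum (λ l → μ l * (1ℚ - ⟦ A i l ⟧ * (2ℚ - x l i)))
    c*Q i = begin-equality
      c * (I * sum term)     ≡⟨ ℚ.*-assoc c I (sum term) ⟨
      c * I * sum term       ≡⟨ cong (_* sum term) (*-inv 0<c) ⟩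
      1ℚ * sum term          ≡⟨ ℚ.*-identityˡ (sum term) ⟩
      sum term               ≡⟨ sum-cong-≗ split ⟩
      sum (λ l → ⟦ N U i l ⟧ + μ l * (1ℚ - ⟦ A i l ⟧ * (2ℚ - x l i)))
                             ≡⟨ ∑-distrib-+ (λ l → ⟦ N U i l ⟧) (λ l → μ l * (1ℚ - ⟦ A i l ⟧ * (2ℚ - x l i))) ⟩
      card (N U i) + sum (λ l → μ l * (1ℚ - ⟦ A i l ⟧ * (2ℚ - x l i))) ∎
      where
      term : Fin n → ℚ
      term w = ⟦ U w ⟧ * φ ⟦ A u w ⟧ ⟦ A i w ⟧ (x w i)
      split : ∀ l → term l ≡ ⟦ N U i l ⟧ + μ l * (1ℚ - ⟦ A i l ⟧ * (2ℚ - x l i))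
      split l rewrite ⟦N⟧ U i l | ⟦N⟧ U u l =
        solve 4 (λ p a b y → p :* (a :+ b :- a :* b :* (con 2ℚ :- y)) := p :* b :+ p :* a :* (con 1ℚ :- b :* (con 2ℚ :- y)))
          refl ⟦ U l ⟧ ⟦ A u l ⟧ ⟦ A i l ⟧ (x l i)

    -- The induction hypothesis for u inside N(i) is taken at the parameter `θ * Q i` and multiplied
    -- by `G i * G i`. Since `Q i * G i` is 1, its θ terms lose their dependence on `Q i` except for
    -- one factor `G i`, and `c * Q i` turns into `c * G i`.
    neighbour-bound : ∀ {i} → N U u i ≡ true → 2ℚ * θ * G i - θ * θ * P i + sum (λ l → μ l * t i l) ≤ c * G i
    neighbour-bound {i} Ni = begin
      2ℚ * θ * g - θ * θ * P i + sum (λ l → μ l * t i l)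
        ≡⟨ cong₂ _+_ normalise split ⟩
      g * g * (2ℚ * (θ * Q i) - θ * Q i * (θ * Q i) * P i) + g * g * (R + W)
        ≡⟨ solve 4 (λ g a r w → g :* g :* a :+ g :* g :* (r :+ w) := g :* g :* (a :+ r :+ w)) refl g (2ℚ * (θ * Q i) - θ * Q i * (θ * Q i) * P i) R W ⟩
      g * g * (2ℚ * (θ * Q i) - θ * Q i * (θ * Q i) * P i + R + W)
        ≤⟨ *-monoˡ (0≤p² g) (ℚ.+-monoˡ-≤ W (sum-inv-q≤ k (N U i) u (free i Ui) Nu (θ * Q i))) ⟩
      g * g * (card (N U i) + W)
        ≡⟨ cong (g * g *_) (c*Q i) ⟨
      g * g * (c * Q i)
        ≡⟨ solve 3 (λ g c Q → g :* g :* (c :* Q) := c :* (Q :* g :* g)) refl g c (Q i) ⟩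
      c * (Q i * g * g)
        ≡⟨ cong (λ z → c * (z * g)) (*-inv 0<Q) ⟩
      c * (1ℚ * g)
        ≡⟨ cong (c *_) (ℚ.*-identityˡ g) ⟩
      c * g ∎
      where
      open Neighbour Ni
      g = G i
      R = sum λ l → ⟦ N (N U i) u l ⟧ * inv (x i l)
      W = sum λ l → μ l * (1ℚ - ⟦ A i l ⟧ * (2ℚ - x l i))
      normalise : 2ℚ * θ * g - θ * θ * P i ≡ g * g * (2ℚ * (θ * Q i) - θ * Q i * (θ * Q i) * P i)
      normalise = sym (begin-equality
        g * g * (2ℚ * (θ * Q i) - θ * Q i * (θ * Q i) * P i)
          ≡⟨ solve 4 (λ g t Q P → g :* g :* (con 2ℚ :* (t :* Q) :- t :* Q :* (t :* Q) :* P)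
               := con 2ℚ :* t :* g :* (Q :* g) :- t :* t :* (Q :* g :* (Q :* g)) :* P) refl g θ (Q i) (P i) ⟩
        2ℚ * θ * g * (Q i * g) - θ * θ * (Q i * g * (Q i * g)) * P i
          ≡⟨ cong (λ z → 2ℚ * θ * g * z - θ * θ * (z * z) * P i) (*-inv 0<Q) ⟩
        2ℚ * θ * g * 1ℚ - θ * θ * (1ℚ * 1ℚ) * P i
          ≡⟨ solve 3 (λ g t P → con 2ℚ :* t :* g :* con 1ℚ :- t :* t :* (con 1ℚ :* con 1ℚ) :* P
               := con 2ℚ :* t :* g :- t :* t :* P) refl g θ (P i) ⟩
        2ℚ * θ * g - θ * θ * P i ∎)
      entry : ∀ l → μ l * t i l ≡ g * g * (⟦ N (N U i) u l ⟧ * inv (x i l) + μ l * (1ℚ - ⟦ A i l ⟧ * (2ℚ - x l i)))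
      entry l rewrite ⟦N⟧ (N U i) u l | ⟦N⟧ U i l | ⟦N⟧ U u l =
        solve 6 (λ p a b g X y → p :* a :* (g :* g :+ b :* (g :* g :* X :- g :* g :* (con 2ℚ :- y)))
                  := g :* g :* (p :* b :* a :* X :+ p :* a :* (con 1ℚ :- b :* (con 2ℚ :- y))))
          refl ⟦ U l ⟧ ⟦ A u l ⟧ ⟦ A i l ⟧ g (inv (x i l)) (x l i)
      split : sum (λ l → μ l * t i l) ≡ g * g * (R + W)
      split = begin-equality
        sum (λ l → μ l * t i l)
          ≡⟨ sum-cong-≗ entry ⟩
        sum (λ l → g * g * (⟦ N (N U i) u l ⟧ * inv (x i l) + μ l * (1ℚ - ⟦ A i l ⟧ * (2ℚ - x l i))))
          ≡⟨ *-distribˡ-sum (g * g) (λ l → ⟦ N (N U i) u l ⟧ * inv (x i l) + μ l * (1ℚ - ⟦ A i l ⟧ * (2ℚ - x l i))) ⟨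
        g * g * sum (λ l → ⟦ N (N U i) u l ⟧ * inv (x i l) + μ l * (1ℚ - ⟦ A i l ⟧ * (2ℚ - x l i)))
          ≡⟨ cong (g * g *_) (∑-distrib-+ (λ l → ⟦ N (N U i) u l ⟧ * inv (x i l)) (λ l → μ l * (1ℚ - ⟦ A i l ⟧ * (2ℚ - x l i)))) ⟩
        g * g * (R + W) ∎

    -- One ordered pair alone can give a negative value, hence the symmetrisation. Adjacent i and l
    -- yield `pair-gap`; otherwise the reciprocals drop out and the square of `G i - G l` remains.
    pair : ∀ {i l} → N U u i ≡ true → N U u l ≡ true → 0ℚ ≤ t i l - G i * G l + (t l i - G l * G i)
    pair {i} {l} Ni Nl with A i l in Ail | A l i | A-sym i l
    ... | true | .true | refl = subst (0ℚ ≤_)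
      (solve 6 (λ a b x y X Y →
         (a :- b) :* (a :- b) :+ a :* a :* Y :+ b :* b :* X :- (a :* a :* (con 2ℚ :- x) :+ b :* b :* (con 2ℚ :- y))
         := a :* a :+ con 1ℚ :* (a :* a :* Y :- a :* a :* (con 2ℚ :- x)) :- a :* b
            :+ (b :* b :+ con 1ℚ :* (b :* b :* X :- b :* b :* (con 2ℚ :- y)) :- b :* a))
         refl (G i) (G l) (x l i) (x i l) (inv (x l i)) (inv (x i l)))
      (0≤pair-gap (0≤G Ni) (0≤G Nl) (proj₁ li) (proj₂ li) (proj₁ il) (proj₂ il))
      where
      open Neighbour using (0≤G)
      il = x-bounds Ni Nl Ail
      li = x-bounds Nl Ni (A-true {i} Ail)
    ... | false | .false | refl = subst (0ℚ ≤_)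
      (solve 4 (λ a b r s → (a :- b) :* (a :- b)
         := a :* a :+ con 0ℚ :* r :- a :* b :+ (b :* b :+ con 0ℚ :* s :- b :* a))
         refl (G i) (G l) (G i * G i * inv (x i l) - G i * G i * (2ℚ - x l i)) (G l * G l * inv (x l i) - G l * G l * (2ℚ - x i l)))
      (0≤p² (G i - G l))

    0≤f+f : ∀ i l → 0ℚ ≤ f i l + f l i
    0≤f+f i l = subst (0ℚ ≤_)
      (solve 4 (λ m l a b → m :* (l :* (a :+ b)) := m :* (l :* a) :+ l :* (m :* b)) refl (μ i) (μ l) (t i l - G i * G l) (t l i - G l * G i))
      (0≤⟦⟧* (N U u i) λ Ni → 0≤⟦⟧* (N U u l) λ Nl → pair Ni Nl)

    -- `neighbour-bound` is summed over the neighbours of u; by `pair`, the double sum of the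
    -- `t i l` that appears is at least that of `G i * G l`, which is S².
    total : 2ℚ * θ * S - θ * θ * T + S * S ≤ c * S
    total = begin
      2ℚ * θ * S - θ * θ * T + S * S
        ≤⟨ p≤p+q (2ℚ * θ * S - θ * θ * T + S * S) (sum²-symmetrise f 0≤f+f) ⟩
      2ℚ * θ * S - θ * θ * T + S * S + sum (λ i → sum (f i))
        ≡⟨ cong₂ (λ y z → y + S * S + z) linear (sum-cong-≗ inner) ⟩
      sum (λ i → μ i * (2ℚ * θ * G i - θ * θ * P i)) + S * S + sum (λ i → μ i * (sum (λ l → μ l * t i l) - G i * S))
        ≡⟨ cong (λ z → sum (λ i → μ i * (2ℚ * θ * G i - θ * θ * P i)) + z + sum (λ i → μ i * (sum (λ l → μ l * t i l) - G i * S)))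
             (*-distribʳ-sum S (λ i → μ i * G i)) ⟩
      sum (λ i → μ i * (2ℚ * θ * G i - θ * θ * P i)) + sum (λ i → μ i * G i * S) + sum (λ i → μ i * (sum (λ l → μ l * t i l) - G i * S))
        ≡⟨ cong (_+ sum (λ i → μ i * (sum (λ l → μ l * t i l) - G i * S)))
             (∑-distrib-+ (λ i → μ i * (2ℚ * θ * G i - θ * θ * P i)) (λ i → μ i * G i * S)) ⟨
      sum (λ i → μ i * (2ℚ * θ * G i - θ * θ * P i) + μ i * G i * S) + sum (λ i → μ i * (sum (λ l → μ l * t i l) - G i * S))
        ≡⟨ ∑-distrib-+ (λ i → μ i * (2ℚ * θ * G i - θ * θ * P i) + μ i * G i * S) (λ i → μ i * (sum (λ l → μ l * t i l) - G i * S)) ⟨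
      sum (λ i → μ i * (2ℚ * θ * G i - θ * θ * P i) + μ i * G i * S + μ i * (sum (λ l → μ l * t i l) - G i * S))
        ≡⟨ sum-cong-≗ (λ i → solve 5 (λ m a g S s → m :* a :+ m :* g :* S :+ m :* (s :- g :* S) := m :* (a :+ s)) refl
             (μ i) (2ℚ * θ * G i - θ * θ * P i) (G i) S (sum (λ l → μ l * t i l))) ⟩
      sum (λ i → μ i * (2ℚ * θ * G i - θ * θ * P i + sum (λ l → μ l * t i l)))
        ≤⟨ sum-mono (λ i → ⟦⟧-mono (N U u i) neighbour-bound) ⟩
      sum (λ i → μ i * (c * G i))
        ≡⟨ sum-cong-≗ (λ i → solve 3 (λ m c g → m :* (c :* g) := c :* (m :* g)) refl (μ i) c (G i)) ⟩
      sum (λ i → c * (μ i * G i))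
        ≡⟨ *-distribˡ-sum c (λ i → μ i * G i) ⟨
      c * S ∎
      where
      linear : 2ℚ * θ * S - θ * θ * T ≡ sum (λ i → μ i * (2ℚ * θ * G i - θ * θ * P i))
      linear = begin-equality
        2ℚ * θ * S - θ * θ * T
          ≡⟨ cong₂ _-_ (*-distribˡ-sum (2ℚ * θ) (λ i → μ i * G i)) (*-distribˡ-sum (θ * θ) (λ i → μ i * P i)) ⟩
        sum (λ i → 2ℚ * θ * (μ i * G i)) - sum (λ i → θ * θ * (μ i * P i))
          ≡⟨ sum-- (λ i → 2ℚ * θ * (μ i * G i)) (λ i → θ * θ * (μ i * P i)) ⟨
        sum (λ i → 2ℚ * θ * (μ i * G i) - θ * θ * (μ i * P i))
          ≡⟨ sum-cong-≗ (λ i → solve 4 (λ t m g p → con 2ℚ :* t :* (m :* g) :- t :* t :* (m :* p) := m :* (con 2ℚ :* t :* g :- t :* t :* p))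
               refl θ (μ i) (G i) (P i)) ⟩
        sum (λ i → μ i * (2ℚ * θ * G i - θ * θ * P i)) ∎
      inner : ∀ i → sum (f i) ≡ μ i * (sum (λ l → μ l * t i l) - G i * S)
      inner i = begin-equality
        sum (f i)
          ≡⟨ *-distribˡ-sum (μ i) (λ l → μ l * (t i l - G i * G l)) ⟨
        μ i * sum (λ l → μ l * (t i l - G i * G l))
          ≡⟨ cong (μ i *_) (sum-cong-≗ (λ l → solve 4 (λ m t g h → m :* (t :- g :* h) := m :* t :- g :* (m :* h)) refl (μ l) (t i l) (G i) (G l))) ⟩
        μ i * sum (λ l → μ l * t i l - G i * (μ l * G l))
          ≡⟨ cong (μ i *_) (sum-- (λ l → μ l * t i l) (λ l → G i * (μ l * G l))) ⟩
        μ i * (sum (λ l → μ l * t i l) - sum (λ l → G i * (μ l * G l)))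
          ≡⟨ cong (λ z → μ i * (sum (λ l → μ l * t i l) - z)) (*-distribˡ-sum (G i) (λ l → μ l * G l)) ⟨
        μ i * (sum (λ l → μ l * t i l) - G i * S) ∎

  V : VertexSet
  V _ = true

  -- Summing `sum-inv-q≤` over u with one common θ leaves only the sum of `π`, at most j + 1. This
  -- is ∑ 1/π ≥ n² / ∑ π in linear form.
  sum²-inv-q≤ : ∀ j → Free (suc j) V →
                sum (λ u → sum λ v → ⟦ A u v ⟧ * inv (q (suc j) V u v)) ≤ (1ℚ - 1/1+ j) * (fromℕ n * fromℕ n)
  sum²-inv-q≤ j free = begin
    sum (λ u → R u)
      ≤⟨ sum-mono (λ u → ℚ.≤-trans (p+q≤r⇒q≤r-p (2ℚ * θ - θ * θ * π (suc j) V u) (R u) (sum-inv-q≤ (suc j) V u free refl θ))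
                                    (ℚ.≤-reflexive (rearrange u))) ⟩
    sum (λ u → 1ℚ * (m - 2ℚ * θ) + θ * θ * (1ℚ * π (suc j) V u))
      ≡⟨ ∑-distrib-+ (λ u → 1ℚ * (m - 2ℚ * θ)) (λ u → θ * θ * (1ℚ * π (suc j) V u)) ⟩
    sum {n} (λ u → 1ℚ * (m - 2ℚ * θ)) + sum (λ u → θ * θ * (1ℚ * π (suc j) V u))
      ≡⟨ cong₂ _+_ (sum-const n (1ℚ * (m - 2ℚ * θ))) (sym (*-distribˡ-sum (θ * θ) (λ u → 1ℚ * π (suc j) V u))) ⟩
    m * (1ℚ * (m - 2ℚ * θ)) + θ * θ * sum (λ u → 1ℚ * π (suc j) V u)
      ≤⟨ ℚ.+-monoʳ-≤ (m * (1ℚ * (m - 2ℚ * θ))) (*-monoˡ (0≤p² θ) (sum-π≤ (suc j) V free)) ⟩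
    m * (1ℚ * (m - 2ℚ * θ)) + θ * θ * fromℕ (suc j)
      ≡⟨ solve 3 (λ m i w → m :* (con 1ℚ :* (m :- con 2ℚ :* (m :* i))) :+ m :* i :* (m :* i) :* w
                    := (con 1ℚ :- i :- (i :- w :* i :* i)) :* (m :* m)) refl m i (fromℕ (suc j)) ⟩
    (1ℚ - i - (i - fromℕ (suc j) * i * i)) * (m * m)
      ≡⟨ cong (λ z → (1ℚ - i - (i - z * i)) * (m * m)) (1/1+-inverse j) ⟩
    (1ℚ - i - (i - 1ℚ * i)) * (m * m)
      ≡⟨ solve 2 (λ i m → (con 1ℚ :- i :- (i :- con 1ℚ :* i)) :* m := (con 1ℚ :- i) :* m) refl i (m * m) ⟩
    (1ℚ - i) * (m * m) ∎
    where
    m = fromℕ n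
    i = 1/1+ j
    -- The minimiser of θ² ω − 2 θ n.
    θ = m * i
    R : Fin n → ℚ
    R u = sum λ v → ⟦ A u v ⟧ * inv (q (suc j) V u v)
    rearrange : ∀ u → card V - (2ℚ * θ - θ * θ * π (suc j) V u) ≡ 1ℚ * (m - 2ℚ * θ) + θ * θ * (1ℚ * π (suc j) V u)
    rearrange u = trans (cong (λ c → c - (2ℚ * θ - θ * θ * π (suc j) V u)) (trans (sum-const n 1ℚ) (ℚ.*-identityʳ m)))
      (solve 3 (λ m t p → m :- (con 2ℚ :* t :- t :* t :* p) := con 1ℚ :* (m :- con 2ℚ :* t) :+ t :* t :* (con 1ℚ :* p))
        refl m θ (π (suc j) V u))

  -- Coefficient matrices with asymptotically nonnegative pairing against the approximants of M.

  module DoublyNonnegativeSequence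
    (a : Fin n → Fin n → ℕ → ℚ) (0≲a : ∀ u v → 0≲ a u v)
    (a-psd : ∀ (x : Fin n → ℚ) → 0≲ (λ m → sum λ u → sum λ v → x u * a u v m * x v)) where

    ⟨_,a⟩ : (Fin n → Fin n → ℚ) → ℕ → ℚ
    ⟨ c ,a⟩ m = sum λ u → sum λ v → c u v * a u v m

    -- A record, so that c can be inferred from a proof of Valid c.
    record Valid (c : Fin n → Fin n → ℚ) : Set where
      constructor valid
      field
        0≲⟨,a⟩ : 0≲ ⟨ c ,a⟩

    open Valid public

    valid-cong : ∀ {c d} → (∀ u v → c u v ≡ d u v) → Valid c → Valid d
    valid-cong {c} {d} c≡d vc = valid (0≲-cong {⟨ c ,a⟩} {⟨ d ,a⟩} (λ m → sum-cong-≗ λ u → sum-cong-≗ λ v → cong (_* a u v m) (c≡d u v)) (0≲⟨,a⟩ vc))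

    valid-nonneg : ∀ {c} → (∀ u v → 0ℚ ≤ c u v) → Valid c
    valid-nonneg {c} 0≤c = valid (0≲-sum² λ u v → 0≲-* (c u v) (0≤c u v) (0≲a u v))

    valid-+ : ∀ {c d} → Valid c → Valid d → Valid (λ u v → c u v + d u v)
    valid-+ {c} {d} vc vd = valid (0≲-cong
      (λ m → trans (sym (sum²-+ (λ u v → c u v * a u v m) (λ u v → d u v * a u v m)))
        (sum-cong-≗ λ u → sum-cong-≗ λ v → sym (ℚ.*-distribʳ-+ (a u v m) (c u v) (d u v))))
      (0≲-+ (0≲⟨,a⟩ vc) (0≲⟨,a⟩ vd)))

    valid-* : ∀ {c} s → 0ℚ ≤ s → Valid c → Valid (λ u v → s * c u v)
    valid-* {c} s 0≤s vc = valid (0≲-cong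
      (λ m → trans (sym (sum²-* s (λ u v → c u v * a u v m)))
        (sum-cong-≗ λ u → sum-cong-≗ λ v → sym (ℚ.*-assoc s (c u v) (a u v m))))
      (0≲-* s 0≤s (0≲⟨,a⟩ vc)))

    valid-sum : ∀ {k} {c : Fin k → Fin n → Fin n → ℚ} → (∀ w → Valid (c w)) → Valid (λ u v → sum λ w → c w u v)
    valid-sum {zero}  h = valid-nonneg λ _ _ → ℚ.≤-refl
    valid-sum {suc k} h = valid-+ (h Fin.zero) (valid-sum λ w → h (Fin.suc w))

    valid-square : ∀ (x : Fin n → ℚ) → Valid (λ u v → x u * x v)
    valid-square x = valid (0≲-cong
      (λ m → sum-cong-≗ λ u → sum-cong-≗ λ v → solve 3 (λ x a y → x :* a :* y := x :* y :* a) refl (x u) (a u v m) (x v))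
      (a-psd x))

    valid-⟦⟧* : ∀ b {c} → (b ≡ true → Valid c) → Valid (λ u v → ⟦ b ⟧ * c u v)
    valid-⟦⟧* true      h = valid-* 1ℚ (ℚ.nonNegative⁻¹ 1ℚ) (h refl)
    valid-⟦⟧* false {c} h = valid-nonneg λ u v → ℚ.≤-reflexive (sym (ℚ.*-zeroˡ (c u v)))

    -- (k − 1) J − k (A ∘ q) restricted to U, with k shifted by one.
    C : ℕ → VertexSet → Fin n → Fin n → ℚ
    C k U u v = ⟦ U u ⟧ * ⟦ U v ⟧ * (fromℕ k - (fromℕ k + 1ℚ) * (⟦ A u v ⟧ * q (suc k) U u v))

    C-at : ℕ → VertexSet → Fin n → Fin n → Fin n → ℚ
    C-at k U w u v = ⟦ U u ⟧ * ⟦ U v ⟧ * (fromℕ k - (fromℕ k + 1ℚ) * (⟦ A u v ⟧ * φ ⟦ A u w ⟧ ⟦ A v w ⟧ (q k (N U w) u v)))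

    ⟦⟧*inv-card : ∀ U u → ⟦ U u ⟧ * (inv (card U) * card U) ≡ ⟦ U u ⟧
    ⟦⟧*inv-card U u with U u in Uu
    ... | true  = trans (ℚ.*-identityˡ (inv (card U) * card U)) (trans (ℚ.*-comm (inv (card U)) (card U)) (*-inv (0<card U Uu)))
    ... | false = ℚ.*-zeroˡ (inv (card U) * card U)

    -- `C` is affine in the weight, so it inherits the average over w. Its constant part requires
    -- `inv (card U) * card U` to be 1; when U is empty, the factor `⟦ U u ⟧` is 0 instead.
    C≡average : ∀ k U u v → sum (λ w → inv (card U) * (⟦ U w ⟧ * C-at k U w u v)) ≡ C k U u v
    C≡average k U u v = begin-equality
      sum (λ w → I * (⟦ U w ⟧ * C-at k U w u v))
        ≡⟨ sum-cong-≗ (λ w → solve 7 (λ I s p r κ A f → I :* (s :* (p :* r :* (κ :- (κ :+ con 1ℚ) :* (A :* f))))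
             := p :* I :* r :* κ :* s :- p :* r :* (κ :+ con 1ℚ) :* A :* I :* (s :* f)) refl
             I ⟦ U w ⟧ p r κ α (f w)) ⟩
      sum (λ w → p * I * r * κ * ⟦ U w ⟧ - p * r * (κ + 1ℚ) * α * I * (⟦ U w ⟧ * f w))
        ≡⟨ sum-- (λ w → p * I * r * κ * ⟦ U w ⟧) (λ w → p * r * (κ + 1ℚ) * α * I * (⟦ U w ⟧ * f w)) ⟩
      sum (λ w → p * I * r * κ * ⟦ U w ⟧) - sum (λ w → p * r * (κ + 1ℚ) * α * I * (⟦ U w ⟧ * f w))
        ≡⟨ cong₂ _-_ (*-distribˡ-sum (p * I * r * κ) (λ w → ⟦ U w ⟧)) (*-distribˡ-sum (p * r * (κ + 1ℚ) * α * I) (λ w → ⟦ U w ⟧ * f w)) ⟨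
      p * I * r * κ * card U - p * r * (κ + 1ℚ) * α * I * Φ
        ≡⟨ solve 7 (λ p I r κ c α Φ → p :* I :* r :* κ :* c :- p :* r :* (κ :+ con 1ℚ) :* α :* I :* Φ
             := p :* (I :* c) :* (r :* κ) :- p :* r :* ((κ :+ con 1ℚ) :* (α :* (I :* Φ)))) refl p I r κ (card U) α Φ ⟩
      p * (I * card U) * (r * κ) - p * r * ((κ + 1ℚ) * (α * (I * Φ)))
        ≡⟨ cong (λ z → z * (r * κ) - p * r * ((κ + 1ℚ) * (α * (I * Φ)))) (⟦⟧*inv-card U u) ⟩
      p * (r * κ) - p * r * ((κ + 1ℚ) * (α * (I * Φ)))
        ≡⟨ solve 4 (λ p r κ z → p :* (r :* κ) :- p :* r :* z := p :* r :* (κ :- z)) refl p r κ ((κ + 1ℚ) * (α * (I * Φ))) ⟩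
      p * r * (κ - (κ + 1ℚ) * (α * (I * Φ))) ∎
      where
      I = inv (card U)
      p = ⟦ U u ⟧
      r = ⟦ U v ⟧
      κ = fromℕ k
      α = ⟦ A u v ⟧
      f : Fin n → ℚ
      f w = φ ⟦ A u w ⟧ ⟦ A v w ⟧ (q k (N U w) u v)
      Φ = sum λ w → ⟦ U w ⟧ * f w

    mutual
      valid-C : ∀ k U → Free (suc k) U → Valid (C k U)
      valid-C k U free = valid-cong (C≡average k U)
        (valid-sum λ w → valid-* (inv (card U)) (0≤inv (0≤card U)) (valid-⟦⟧* (U w) λ Uw → valid-C-at k U w (free w Uw)))

      -- For k = 0 no vertex of U is adjacent to w, so every entry is 0. In the successor case κ
      -- times the matrix is a rank-one square, plus κ + 1 times `C` on N(w), plus a nonnegative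
      -- matrix.
      valid-C-at : ∀ k U w → Free k (N U w) → Valid (C-at k U w)
      valid-C-at zero U w empty = valid-nonneg λ u v → ℚ.≤-reflexive (sym (begin-equality
        ⟦ U u ⟧ * ⟦ U v ⟧ * (0ℚ - (0ℚ + 1ℚ) * (⟦ A u v ⟧ * φ ⟦ A u w ⟧ ⟦ A v w ⟧ 1ℚ))
          ≡⟨ solve 5 (λ p r α a b → p :* r :* (con 0ℚ :- (con 0ℚ :+ con 1ℚ) :* (α :* (a :+ b :- a :* b :* (con 2ℚ :- con 1ℚ))))
               := p :* a :* (r :* α :* (b :- con 1ℚ)) :- r :* b :* (p :* α)) refl ⟦ U u ⟧ ⟦ U v ⟧ ⟦ A u v ⟧ ⟦ A u w ⟧ ⟦ A v w ⟧ ⟩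
        ⟦ U u ⟧ * ⟦ A u w ⟧ * (⟦ U v ⟧ * ⟦ A u v ⟧ * (⟦ A v w ⟧ - 1ℚ)) - ⟦ U v ⟧ * ⟦ A v w ⟧ * (⟦ U u ⟧ * ⟦ A u v ⟧)
          ≡⟨ cong₂ (λ y z → y * (⟦ U v ⟧ * ⟦ A u v ⟧ * (⟦ A v w ⟧ - 1ℚ)) - z * (⟦ U u ⟧ * ⟦ A u v ⟧)) (vanish u) (vanish v) ⟩
        0ℚ * (⟦ U v ⟧ * ⟦ A u v ⟧ * (⟦ A v w ⟧ - 1ℚ)) - 0ℚ * (⟦ U u ⟧ * ⟦ A u v ⟧)
          ≡⟨ solve 2 (λ y z → con 0ℚ :* y :- con 0ℚ :* z := con 0ℚ) refl (⟦ U v ⟧ * ⟦ A u v ⟧ * (⟦ A v w ⟧ - 1ℚ)) (⟦ U u ⟧ * ⟦ A u v ⟧) ⟩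
        0ℚ ∎))
        where
        vanish : ∀ x → ⟦ U x ⟧ * ⟦ A x w ⟧ ≡ 0ℚ
        vanish x rewrite A-sym x w = trans (sym (⟦N⟧ U w x)) (cong ⟦_⟧ (empty x))
      valid-C-at (suc k) U w free = valid-cong identity
        (valid-* (inv κ) (0≤inv (ℚ.<⇒≤ 0<κ))
          (valid-+ (valid-+ (valid-square x) (valid-* (κ + 1ℚ) 0≤κ+1 (valid-C k (N U w) free)))
                   (valid-nonneg 0≤rest)))
        where
        κ = fromℕ k + 1ℚ
        0<κ : 0ℚ < κ
        0<κ = ℚ.+-mono-≤-< (0≤fromℕ k) (ℚ.positive⁻¹ 1ℚ)
        0≤κ+1 : 0ℚ ≤ κ + 1ℚ
        0≤κ+1 = ℚ.+-mono-≤ (ℚ.<⇒≤ 0<κ) (ℚ.nonNegative⁻¹ 1ℚ)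
        -- `x` is 1 on N(w) and -κ on the rest of U. Its square is then exact on pairs outside N(w)
        -- and on adjacent mixed pairs, and leaves `κ + 1` times `C` inside N(w); `rest` fills in
        -- the non-adjacent mixed pairs.
        x : Fin n → ℚ
        x u = ⟦ U u ⟧ * (⟦ A u w ⟧ - κ * (1ℚ - ⟦ A u w ⟧))
        rest : Fin n → Fin n → ℚ
        rest u v = (κ + 1ℚ) * κ * (⟦ U u ⟧ * ⟦ U v ⟧ * (⟦ A u w ⟧ * (1ℚ - ⟦ A v w ⟧) + ⟦ A v w ⟧ * (1ℚ - ⟦ A u w ⟧)) * (1ℚ - ⟦ A u v ⟧))
        0≤1-⟦_⟧ : ∀ b → 0ℚ ≤ 1ℚ - ⟦ b ⟧
        0≤1-⟦ true ⟧  = ℚ.≤-refl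
        0≤1-⟦ false ⟧ = ℚ.nonNegative⁻¹ 1ℚ
        0≤rest : ∀ u v → 0ℚ ≤ rest u v
        0≤rest u v = *-nonNeg (*-nonNeg 0≤κ+1 (ℚ.<⇒≤ 0<κ))
          (*-nonNeg (*-nonNeg (*-nonNeg 0≤⟦ U u ⟧ 0≤⟦ U v ⟧)
                              (ℚ.+-mono-≤ (*-nonNeg 0≤⟦ A u w ⟧ 0≤1-⟦ A v w ⟧) (*-nonNeg 0≤⟦ A v w ⟧ 0≤1-⟦ A u w ⟧)))
                    0≤1-⟦ A u v ⟧)
        identity : ∀ u v → inv κ * (x u * x v + (κ + 1ℚ) * C k (N U w) u v + rest u v) ≡ C-at (suc k) U w u v
        identity u v rewrite ⟦N⟧ U w u | ⟦N⟧ U w v | A-sym w u | A-sym w v | fromℕ-suc k = begin-equality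
          inv κ * (x u * x v + (κ + 1ℚ) * (p * a₁ * (r * b) * (fromℕ k - κ * (α * y))) + rest u v)
            ≡⟨ solve 8 (λ K j p r α a b y → let κ = j :+ con 1ℚ in
                 K :* (p :* (a :- κ :* (con 1ℚ :- a)) :* (r :* (b :- κ :* (con 1ℚ :- b)))
                   :+ (κ :+ con 1ℚ) :* (p :* a :* (r :* b) :* (j :- κ :* (α :* y)))
                   :+ (κ :+ con 1ℚ) :* κ :* (p :* r :* (a :* (con 1ℚ :- b) :+ b :* (con 1ℚ :- a)) :* (con 1ℚ :- α)))
                 := κ :* K :* (p :* r :* (κ :- (κ :+ con 1ℚ) :* (α :* (a :+ b :- a :* b :* (con 2ℚ :- y))))))
                 refl (inv κ) (fromℕ k) p r α a₁ b y ⟩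
          κ * inv κ * target
            ≡⟨ cong (_* target) (*-inv 0<κ) ⟩
          1ℚ * target
            ≡⟨ ℚ.*-identityˡ target ⟩
          target ∎
          where
          p = ⟦ U u ⟧
          r = ⟦ U v ⟧
          α = ⟦ A u v ⟧
          a₁ = ⟦ A u w ⟧
          b = ⟦ A v w ⟧
          y = q (suc k) (N U w) u v
          target = p * r * (κ - (κ + 1ℚ) * (α * φ a₁ b y))

    -- The Cauchy-Schwarz step for approximate roots, with its error terms.

    module EdgeSum (j : ℕ) (free : Free (suc j) V) where

      w : Fin n → Fin n → ℚ
      w = q (suc j) V

      ρ ν : ℚ
      ρ = 1ℚ - 1/1+ j
      ν = fromℕ n

      S X Y : ℕ → ℚ
      S m = sum λ u → sum λ v → a u v m
      X m = sum λ u → sum λ v → ⟦ A u v ⟧ * √≈ m (a u v m)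
      Y m = sum λ u → sum λ v → ⟦ A u v ⟧ * (w u v * (√≈ m (a u v m) * √≈ m (a u v m)))

      0≤ρ : 0ℚ ≤ ρ
      0≤ρ = 0≤q-p (1/1+-antimono {0} {j} ℕ.z≤n)

      w-bounds : ∀ {u v} → A u v ≡ true → 0ℚ < w u v × w u v ≤ 1ℚ
      w-bounds = q-bounds (suc j) free refl refl

      valid-ρ-w : Valid (λ u v → ρ - ⟦ A u v ⟧ * w u v)
      valid-ρ-w = valid-cong entry (valid-* (1/1+ j) (ℚ.<⇒≤ (0<1/1+n j)) (valid-C j V free))
        where
        [j+1]/[j+1] : (fromℕ j + 1ℚ) * 1/1+ j ≡ 1ℚ
        [j+1]/[j+1] = trans (cong (_* 1/1+ j) (sym (fromℕ-suc j))) (1/1+-inverse j)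
        entry : ∀ u v → 1/1+ j * C j V u v ≡ ρ - ⟦ A u v ⟧ * w u v
        entry u v = begin-equality
          1/1+ j * (1ℚ * 1ℚ * (fromℕ j - (fromℕ j + 1ℚ) * (⟦ A u v ⟧ * w u v)))
            ≡⟨ solve 3 (λ i j z → i :* (con 1ℚ :* con 1ℚ :* (j :- (j :+ con 1ℚ) :* z))
                 := (j :+ con 1ℚ) :* i :- i :- (j :+ con 1ℚ) :* i :* z) refl (1/1+ j) (fromℕ j) (⟦ A u v ⟧ * w u v) ⟩
          (fromℕ j + 1ℚ) * 1/1+ j - 1/1+ j - (fromℕ j + 1ℚ) * 1/1+ j * (⟦ A u v ⟧ * w u v)
            ≡⟨ cong (λ z → z - 1/1+ j - z * (⟦ A u v ⟧ * w u v)) [j+1]/[j+1] ⟩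
          ρ - 1ℚ * (⟦ A u v ⟧ * w u v)
            ≡⟨ cong (λ z → ρ - z) (ℚ.*-identityˡ (⟦ A u v ⟧ * w u v)) ⟩
          ρ - ⟦ A u v ⟧ * w u v ∎

      -- `valid-ρ-w` bounds the weighted sum of the entries; since the weights on edges are
      -- nonnegative, `√≈-square-0≲` lets squared approximate roots replace the entries.
      Y≲ρS : 0≲ (λ m → ρ * S m - Y m)
      Y≲ρS = 0≲-cong combine
        (0≲-+ (0≲⟨,a⟩ valid-ρ-w)
              (0≲-sum² λ u v → 0≲-* (⟦ A u v ⟧ * w u v) (0≤⟦⟧* (A u v) λ Auv → ℚ.<⇒≤ (proj₁ (w-bounds Auv))) (√≈-square-0≲ (0≲a u v))))
        where
        combine : ∀ m → sum (λ u → sum λ v → (ρ - ⟦ A u v ⟧ * w u v) * a u v m)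
                        + sum (λ u → sum λ v → ⟦ A u v ⟧ * w u v * (a u v m - √≈ m (a u v m) * √≈ m (a u v m)))
                        ≡ ρ * S m - Y m
        combine m = begin-equality
          sum (λ u → sum λ v → (ρ - ⟦ A u v ⟧ * w u v) * a u v m)
            + sum (λ u → sum λ v → ⟦ A u v ⟧ * w u v * (a u v m - √≈ m (a u v m) * √≈ m (a u v m)))
            ≡⟨ sum²-+ (λ u v → (ρ - ⟦ A u v ⟧ * w u v) * a u v m)
                      (λ u v → ⟦ A u v ⟧ * w u v * (a u v m - √≈ m (a u v m) * √≈ m (a u v m))) ⟨
          sum (λ u → sum λ v → (ρ - ⟦ A u v ⟧ * w u v) * a u v m + ⟦ A u v ⟧ * w u v * (a u v m - √≈ m (a u v m) * √≈ m (a u v m)))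
            ≡⟨ sum-cong-≗ (λ u → sum-cong-≗ λ v →
                 solve 5 (λ ρ α w a b → (ρ :- α :* w) :* a :+ α :* w :* (a :- b) := ρ :* a :- α :* (w :* b)) refl
                   ρ ⟦ A u v ⟧ (w u v) (a u v m) (√≈ m (a u v m) * √≈ m (a u v m))) ⟩
          sum (λ u → sum λ v → ρ * a u v m - ⟦ A u v ⟧ * (w u v * (√≈ m (a u v m) * √≈ m (a u v m))))
            ≡⟨ sum²-- (λ u v → ρ * a u v m) (λ u v → ⟦ A u v ⟧ * (w u v * (√≈ m (a u v m) * √≈ m (a u v m)))) ⟩
          sum (λ u → sum λ v → ρ * a u v m) - Y m
            ≡⟨ cong (_- Y m) (sum²-* ρ (λ u v → a u v m)) ⟩
          ρ * S m - Y m ∎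

      weighted-AM-GM : ∀ {y} τ β → 0ℚ < y → 2ℚ * τ * ν * β ≤ ν * ν * (y * (β * β)) + τ * τ * inv y
      weighted-AM-GM {y} τ β 0<y = ≤-by-gap (*-nonNeg (ℚ.<⇒≤ (0<inv 0<y)) (0≤p² (ν * y * β - τ))) (begin-equality
        ν * ν * (y * (β * β)) + τ * τ * inv y
          ≡⟨ solve 5 (λ n y b t Y → n :* n :* (y :* (b :* b)) :+ t :* t :* Y
               := con 2ℚ :* t :* n :* b :+ (Y :* ((n :* y :* b :- t) :* (n :* y :* b :- t))
                  :+ (con 1ℚ :- y :* Y) :* (n :* n :* y :* b :* b :- con 2ℚ :* t :* n :* b))) refl ν y β τ (inv y) ⟩
        2ℚ * τ * ν * β + (main + (1ℚ - y * inv y) * r)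
          ≡⟨ cong (λ z → 2ℚ * τ * ν * β + (main + (1ℚ - z) * r)) (*-inv 0<y) ⟩
        2ℚ * τ * ν * β + (main + (1ℚ - 1ℚ) * r)
          ≡⟨ solve 3 (λ a m r → a :+ (m :+ (con 1ℚ :- con 1ℚ) :* r) := a :+ m) refl (2ℚ * τ * ν * β) main r ⟩
        2ℚ * τ * ν * β + main ∎)
        where
        main = inv y * ((ν * y * β - τ) * (ν * y * β - τ))
        r = ν * ν * y * β * β - 2ℚ * τ * ν * β

      -- Weighted AM-GM on each ordered edge, with (2) bounding the reciprocals. If τ² is near `S m`
      -- and `Y m` is at most about `ρ * S m`, the right side is about 2ρν²τ², which returns X ≤
      -- ρντ.
      X≤ : ∀ m τ → 2ℚ * τ * ν * X m ≤ ν * ν * Y m + τ * τ * (ρ * (ν * ν))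
      X≤ m τ = begin
        2ℚ * τ * ν * X m
          ≡⟨ sum²-* (2ℚ * τ * ν) (λ u v → ⟦ A u v ⟧ * β u v) ⟨
        sum (λ u → sum λ v → 2ℚ * τ * ν * (⟦ A u v ⟧ * β u v))
          ≤⟨ sum²-mono entry ⟩
        sum (λ u → sum λ v → ν * ν * (⟦ A u v ⟧ * (w u v * (β u v * β u v))) + τ * τ * (⟦ A u v ⟧ * inv (w u v)))
          ≡⟨ sum²-+ (λ u v → ν * ν * (⟦ A u v ⟧ * (w u v * (β u v * β u v)))) (λ u v → τ * τ * (⟦ A u v ⟧ * inv (w u v))) ⟩
        sum (λ u → sum λ v → ν * ν * (⟦ A u v ⟧ * (w u v * (β u v * β u v)))) + sum (λ u → sum λ v → τ * τ * (⟦ A u v ⟧ * inv (w u v)))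
          ≡⟨ cong₂ _+_ (sum²-* (ν * ν) (λ u v → ⟦ A u v ⟧ * (w u v * (β u v * β u v)))) (sum²-* (τ * τ) (λ u v → ⟦ A u v ⟧ * inv (w u v))) ⟩
        ν * ν * Y m + τ * τ * sum (λ u → sum λ v → ⟦ A u v ⟧ * inv (w u v))
          ≤⟨ ℚ.+-monoʳ-≤ (ν * ν * Y m) (*-monoˡ (0≤p² τ) (sum²-inv-q≤ j free)) ⟩
        ν * ν * Y m + τ * τ * (ρ * (ν * ν)) ∎
        where
        β : Fin n → Fin n → ℚ
        β u v = √≈ m (a u v m)
        entry : ∀ u v → 2ℚ * τ * ν * (⟦ A u v ⟧ * β u v)
                        ≤ ν * ν * (⟦ A u v ⟧ * (w u v * (β u v * β u v))) + τ * τ * (⟦ A u v ⟧ * inv (w u v))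
        entry u v = subst₂ _≤_
          (solve 3 (λ c α b → α :* (c :* b) := c :* (α :* b)) refl (2ℚ * τ * ν) ⟦ A u v ⟧ (β u v))
          (solve 5 (λ c α x d y → α :* (c :* x :+ d :* y) := c :* (α :* x) :+ d :* (α :* y)) refl
            (ν * ν) ⟦ A u v ⟧ (w u v * (β u v * β u v)) (τ * τ) (inv (w u v)))
          (⟦⟧-mono (A u v) λ Auv → weighted-AM-GM τ (β u v) (proj₁ (w-bounds Auv)))

      4ℚ : ℚ
      4ℚ = 2ℚ * 2ℚ

      -- Replacing √≈ m (S m) by τ, which is bounded below by η, lets us cancel τ
      -- without knowing whether the total weight is zero.
      X-bound : ∀ {η δ} m → 0ℚ < ν → 0ℚ < η → 1/1+ m ≤ η → ν * δ ≡ η * (4ℚ * ν * η) → 0ℚ ≤ ρ * S m - Y m + δ →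
                X m ≤ ρ * ν * √≈ m (S m) + 4ℚ * ν * η
      X-bound {η} {δ} m 0<ν 0<η i≤η νδ≡ 0≤ρS-Y+δ = *-cancelˡ 0<2τν (begin
        2ℚ * τ * ν * X m
          ≤⟨ X≤ m τ ⟩
        ν * ν * Y m + τ * τ * (ρ * (ν * ν))
          ≤⟨ ≤-by-gap (*-nonNeg (0≤p² ν) (ℚ.+-mono-≤ 0≤ρS-Y+δ (*-nonNeg 0≤ρ (0≤q-p S≤τ²))))
               (solve 6 (λ n d r t S Y → n :* (n :* d) :+ con 2ℚ :* r :* (n :* n) :* (t :* t)
                  := n :* n :* Y :+ t :* t :* (r :* (n :* n)) :+ n :* n :* (r :* S :- Y :+ d :+ r :* (t :* t :- S)))
                  refl ν δ ρ τ (S m) (Y m)) ⟩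
        ν * (ν * δ) + 2ℚ * ρ * (ν * ν) * (τ * τ)
          ≡⟨ cong (λ z → ν * z + 2ℚ * ρ * (ν * ν) * (τ * τ)) νδ≡ ⟩
        ν * (η * (4ℚ * ν * η)) + 2ℚ * ρ * (ν * ν) * (τ * τ)
          -- As ρ ≤ 1 and τ - s = i + η ≤ 2η, replacing one τ by s costs at most 4ν²τη; as η ≤ τ,
          -- the term 4ν²η² coming from δ costs at most as much again. Together this is 2τν · 4νη,
          -- hence the constant `4ℚ`.
          ≤⟨ ≤-by-gap (ℚ.+-mono-≤
               (*-nonNeg (*-nonNeg (ℚ.<⇒≤ 0<2τν) (ℚ.<⇒≤ 0<ν))
                         (ℚ.+-mono-≤ (*-nonNeg 0≤1-ρ (ℚ.+-mono-≤ 0≤i (ℚ.<⇒≤ 0<η))) (0≤q-p i≤η)))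
               (*-nonNeg (*-nonNeg (*-nonNeg (ℚ.nonNegative⁻¹ 4ℚ) (0≤p² ν)) (ℚ.<⇒≤ 0<η)) 0≤s+i))
               (solve 5 (λ n r s i e → let t = s :+ i :+ e in
                  con 2ℚ :* t :* n :* (r :* n :* s :+ con 4ℚ :* n :* e)
                  := n :* (e :* (con 4ℚ :* n :* e)) :+ con 2ℚ :* r :* (n :* n) :* (t :* t)
                     :+ (con 2ℚ :* t :* n :* n :* ((con 1ℚ :- r) :* (i :+ e) :+ (e :- i))
                         :+ con 4ℚ :* (n :* n) :* e :* (s :+ i)))
                  refl ν ρ s i η) ⟩
        2ℚ * τ * ν * (ρ * ν * s + 4ℚ * ν * η) ∎)
        where
        s = √≈ m (S m)
        i = 1/1+ m
        τ = s + i + η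
        0≤i : 0ℚ ≤ i
        0≤i = ℚ.<⇒≤ (0<1/1+n m)
        0≤s+i : 0ℚ ≤ s + i
        0≤s+i = ℚ.+-mono-≤ (0≤√≈ m (S m)) 0≤i
        0<2τν : 0ℚ < 2ℚ * τ * ν
        0<2τν = *-pos (*-pos (ℚ.positive⁻¹ 2ℚ) (ℚ.+-mono-≤-< 0≤s+i 0<η)) 0<ν
        S≤τ² : S m ≤ τ * τ
        S≤τ² = ℚ.≤-trans (ℚ.<⇒≤ (<[√≈+1/1+n]² m (S m))) (square-mono-≤ 0≤s+i (p≤p+q (s + i) (ℚ.<⇒≤ 0<η)))
        0≤1-ρ : 0ℚ ≤ 1ℚ - ρ
        0≤1-ρ = subst (0ℚ ≤_) (solve 1 (λ i → i := con 1ℚ :- (con 1ℚ :- i)) refl (1/1+ j)) (ℚ.<⇒≤ (0<1/1+n j))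

      X≲ρν√S : 0ℚ < ν → 0≲ (λ m → ρ * ν * √≈ m (S m) - X m)
      X≲ρν√S 0<ν = 0≲-intro λ ε 0<ε →
        -- The error 4νη of `X-bound` is set to ε, and δ = ηε/ν is then 4η².
        let η , 0<η , 4νη≡ε = divide {ε} {4ℚ * ν} 0<ε (*-pos (ℚ.positive⁻¹ 4ℚ) 0<ν)
            δ , 0<δ , νδ≡ηε = divide {η * ε} {ν} (*-pos 0<η 0<ε) 0<ν
            K , h = eventually Y≲ρS δ 0<δ
            L , 1/1+L≤η = archimedean 0<η
        in K ℕ.⊔ L , λ m K⊔L≤m → subst (0ℚ ≤_)
          (solve 3 (λ b e x → b :+ e :- x := b :- x :+ e) refl (ρ * ν * √≈ m (S m)) ε (X m))
          (0≤q-p (subst (λ e → X m ≤ ρ * ν * √≈ m (S m) + e) 4νη≡ε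
            (X-bound m 0<ν 0<η (ℚ.≤-trans (1/1+-antimono (ℕ.≤-trans (ℕ.m≤n⊔m K L) K⊔L≤m)) 1/1+L≤η)
              (trans νδ≡ηε (cong (η *_) (sym 4νη≡ε))) (h m (ℕ.≤-trans (ℕ.m≤m⊔n K L) K⊔L≤m)))))

-- From the clique number to the recursive predicate `Free`.

module CliqueNumber {n : ℕ} (G : Defs.Graph n) where

  open Defs.Graph G

  does-true : ∀ {P : Set} (P? : Dec P) → does P? ≡ true → P
  does-true (yes p) refl = p

  A : Fin n → Fin n → Bool
  A u v = does (adj? u v)

  A-sym : ∀ u v → A u v ≡ A v u
  A-sym u v = does-⇔ (mk⇔ symm symm) (adj? u v) (adj? v u)

  A-irrefl : ∀ u → A u u ≡ false
  A-irrefl u = dec-false (adj? u u) (irrefl refl)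

  open EdgeWeights A A-sym A-irrefl using (N; Free; V)
  open Indicators using (∧-trueˡ; ∧-trueʳ)

  module _ {ω : ℕ} (isω : Defs.IsCliqueNumber G ω) where

    open Defs.IsCliqueNumber isω

    insert-clique : ∀ {S x} → Defs.IsClique G S → (∀ {y} → y ∈ S → Adj x y) → Defs.IsClique G (S ∪ ⁅ x ⁆)
    insert-clique {S} {x} cl adj {u} {v} u∈ v∈ u≢v with x∈p∪q⁻ S ⁅ x ⁆ u∈ | x∈p∪q⁻ S ⁅ x ⁆ v∈
    ... | inj₁ u∈S | inj₁ v∈S = cl u∈S v∈S u≢v
    ... | inj₁ u∈S | inj₂ v∈x rewrite x∈⁅y⁆⇒x≡y x v∈x = symm (adj u∈S)
    ... | inj₂ u∈x | inj₁ v∈S rewrite x∈⁅y⁆⇒x≡y x u∈x = adj v∈S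
    ... | inj₂ u∈x | inj₂ v∈x = contradiction (trans (x∈⁅y⁆⇒x≡y x u∈x) (sym (x∈⁅y⁆⇒x≡y x v∈x))) u≢v

    insert-size : ∀ {S x} → (∀ {y} → y ∈ S → Adj x y) → ∣ S ∣ ℕ.< ∣ S ∪ ⁅ x ⁆ ∣
    insert-size {S} {x} adj = p⊂q⇒∣p∣<∣q∣ (p⊆p∪q ⁅ x ⁆ , x , q⊆p∪q S ⁅ x ⁆ (x∈⁅x⁆ x) , λ x∈S → irrefl refl (adj x∈S))

    -- Each unfolding of `Free` moves the chosen vertex into the clique S, while U stays inside the
    -- common neighbourhood of S. Once S has ω vertices, a vertex left in U would extend it to a
    -- clique that is too large.
    free-common-neighbours : ∀ k S U → Defs.IsClique G S → (∀ x → U x ≡ true → ∀ {y} → y ∈ S → Adj x y) →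
                             ω ℕ.≤ ∣ S ∣ ℕ.+ k → Free k U
    free-common-neighbours zero S U cl adj ω≤ x = ¬-not λ Ux → ℕ.<-irrefl refl (ℕ.<-≤-trans
      (ℕ.≤-<-trans (subst (ω ℕ.≤_) (ℕ.+-identityʳ ∣ S ∣) ω≤) (insert-size (adj x Ux)))
      (maximal (S ∪ ⁅ x ⁆) (insert-clique cl (adj x Ux))))
    free-common-neighbours (suc k) S U cl adj ω≤ w Uw =
      free-common-neighbours k (S ∪ ⁅ w ⁆) (N U w) (insert-clique cl (adj w Uw)) adj′
        (ℕ.≤-trans (subst (ω ℕ.≤_) (ℕ.+-suc ∣ S ∣ k) ω≤) (ℕ.+-monoˡ-≤ k (insert-size (adj w Uw))))
      where
      adj′ : ∀ x → N U w x ≡ true → ∀ {y} → y ∈ S ∪ ⁅ w ⁆ → Adj x y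
      adj′ x Nx y∈ with x∈p∪q⁻ S ⁅ w ⁆ y∈
      ... | inj₁ y∈S = adj x (∧-trueˡ (U x) Nx) y∈S
      ... | inj₂ y∈w rewrite x∈⁅y⁆⇒x≡y w y∈w = symm (does-true (adj? w x) (∧-trueʳ (U x) Nx))

    free-V : Free ω V
    free-V = free-common-neighbours ω ⊥ V (λ u∈⊥ → contradiction u∈⊥ ∉⊥) (λ _ _ y∈⊥ → contradiction y∈⊥ ∉⊥)
      (ℕ.≤-reflexive (cong (ℕ._+ ω) (sym (∣⊥∣≡0 n))))

-- Transfer to real matrices and to the sum over undirected edges.

module RealBound {n : ℕ} (G : Defs.Graph n) (M : Defs.Matrix n) (dnn : Defs.DoublyNonnegative M) where

  open import Data.Rational.Base using (_+_; _*_; _-_; _≤_; _<_)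
  open ℚ.≤-Reasoning
  open +-*-Solver using (solve; _:=_; _:+_; _:*_; _:-_; con)
  open Defs using (ℝ; seq; fromℚ; 0ℝ; ∑; ∑E; √_; fromNat)
  open Defs.Rational
  open Defs.DoublyNonnegative dnn
  open RationalLemmas
  open Indicators
  open Asymptotics
  open CliqueNumber G

  seq-∑ : ∀ {k} (f : Fin k → ℝ) m → seq (∑ f) m ≡ sum λ i → seq (f i) m
  seq-∑ {zero}  f m = refl
  seq-∑ {suc k} f m = cong (seq (f Fin.zero) m +_) (seq-∑ (λ i → f (Fin.suc i)) m)

  seq-∑² : ∀ {k} (f : Fin k → Fin k → ℝ) m → seq (∑ λ i → ∑ (f i)) m ≡ sum λ i → sum λ j → seq (f i j) m
  seq-∑² f m = trans (seq-∑ (λ i → ∑ (f i)) m) (sum-cong-≗ λ i → seq-∑ (f i) m)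

  a : Fin n → Fin n → ℕ → ℚ
  a u v m = seq (M u v) m

  0≲a : ∀ u v → 0≲ a u v
  0≲a u v = 0≲-intro (nonnegative u v)

  a-psd : ∀ (x : Fin n → ℚ) → 0≲ (λ m → sum λ u → sum λ v → x u * a u v m * x v)
  a-psd x = 0≲-cong (seq-∑² λ u v → fromℚ (x u) Defs.* M u v Defs.* fromℚ (x v))
    (0≲-intro (positiveSemidefinite λ u → fromℚ (x u)))

  a-symmetric : ∀ u v → 0≲ (λ m → a v u m - a u v m)
  a-symmetric u v = 0≲-intro λ ε 0<ε → let K , h = symmetric u v ε 0<ε in K , λ m K≤m →
    subst (0ℚ ≤_) (solve 3 (λ x y e → e :- (x :- y) := y :- x :+ e) refl (a u v m) (a v u m) ε)
      (0≤q-p (ℚ.≤-trans (p≤∣p∣ (a u v m - a v u m)) (h m K≤m)))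

  β : Fin n → Fin n → ℕ → ℚ
  β u v m = √≈ m (a u v m)

  lt : Fin n → Fin n → Bool
  lt u v = does (u Fin.<? v)

  -- The ordered edges (u , v) and (v , u) together carry twice the value of
  -- the undirected edge, up to the asymmetry of the approximants.
  symmetrised : ∀ b c {u v} → (b ≡ true → c ≢ true) →
                0≲ (λ m → β u v m - 2ℚ * (⟦ b ⟧ * β u v m) + (β v u m - 2ℚ * (⟦ c ⟧ * β v u m)))
  symmetrised true  true          h = contradiction refl (h refl)
  symmetrised true  false {u} {v} h = 0≲-cong
    (λ m → solve 2 (λ x y → y :- x := x :- con 2ℚ :* (con 1ℚ :* x) :+ (y :- con 2ℚ :* (con 0ℚ :* y))) refl (β u v m) (β v u m))
    (√≈-mono-0≲ (a-symmetric u v))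
  symmetrised false true  {u} {v} h = 0≲-cong
    (λ m → solve 2 (λ x y → x :- y := x :- con 2ℚ :* (con 0ℚ :* x) :+ (y :- con 2ℚ :* (con 1ℚ :* y))) refl (β u v m) (β v u m))
    (√≈-mono-0≲ (a-symmetric v u))
  -- Only u = v leads here; for a one-sided bound the nonnegativity of the roots is enough.
  symmetrised false false {u} {v} h = 0≤⇒0≲ λ m → subst (0ℚ ≤_)
    (solve 2 (λ x y → x :+ y := x :- con 2ℚ :* (con 0ℚ :* x) :+ (y :- con 2ℚ :* (con 0ℚ :* y))) refl (β u v m) (β v u m))
    (ℚ.+-mono-≤ (0≤√≈ m (a u v m)) (0≤√≈ m (a v u m)))

  entry : Fin n → Fin n → ℕ → ℚ
  entry u v m = ⟦ A u v ⟧ * (β u v m - 2ℚ * (⟦ lt u v ⟧ * β u v m))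

  0≲entry+entry : ∀ u v → 0≲ (λ m → entry u v m + entry v u m)
  0≲entry+entry u v = 0≲-cong
    (λ m → let x = β u v m - 2ℚ * (⟦ lt u v ⟧ * β u v m)
               y = β v u m - 2ℚ * (⟦ lt v u ⟧ * β v u m)
           in trans (ℚ.*-distribˡ-+ ⟦ A u v ⟧ x y) (cong (λ b → ⟦ A u v ⟧ * x + ⟦ b ⟧ * y) (A-sym u v)))
    (0≲-* ⟦ A u v ⟧ 0≤⟦ A u v ⟧ (symmetrised (lt u v) (lt v u) {u} {v} λ u<v v<u →
      Fin.<-asym (does-true (u Fin.<? v) u<v) (does-true (v Fin.<? u) v<u)))

  X : ℕ → ℚ
  X m = sum λ u → sum λ v → ⟦ A u v ⟧ * β u v m

  2∑E≲X : 0≲ (λ m → X m - 2ℚ * seq (∑E G λ u v → √ M u v) m)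
  2∑E≲X = 0≲-cong (λ m → begin-equality
    sum (λ u → sum λ v → entry u v m)
      ≡⟨ sum-cong-≗ (λ u → sum-cong-≗ λ v → trans
           (solve 3 (λ α x l → α :* (x :- con 2ℚ :* (l :* x)) := α :* x :- con 2ℚ :* (l :* (α :* x))) refl ⟦ A u v ⟧ (β u v m) ⟦ lt u v ⟧)
           (cong (λ z → ⟦ A u v ⟧ * β u v m - 2ℚ * z) (sym (edge-term (lt u v) (A u v) (√ M u v) m)))) ⟩
    sum (λ u → sum λ v → ⟦ A u v ⟧ * β u v m - 2ℚ * seq (edge u v) m)
      ≡⟨ sum²-- (λ u v → ⟦ A u v ⟧ * β u v m) (λ u v → 2ℚ * seq (edge u v) m) ⟩
    X m - sum (λ u → sum λ v → 2ℚ * seq (edge u v) m)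
      ≡⟨ cong (λ z → X m - z) (sum²-* 2ℚ (λ u v → seq (edge u v) m)) ⟩
    X m - 2ℚ * sum (λ u → sum λ v → seq (edge u v) m)
      ≡⟨ cong (λ z → X m - 2ℚ * z) (seq-∑² edge m) ⟨
    X m - 2ℚ * seq (∑E G λ u v → √ M u v) m ∎)
    (0≲-sum²-symmetrise entry 0≲entry+entry)
    where
    edge : Fin n → Fin n → ℝ
    edge u v = if lt u v ∧ A u v then √ M u v else 0ℝ
    edge-term : ∀ b c x m → seq (if b ∧ c then x else 0ℝ) m ≡ ⟦ b ⟧ * (⟦ c ⟧ * seq x m)
    edge-term true  true  x m = solve 1 (λ x → x := con 1ℚ :* (con 1ℚ :* x)) refl (seq x m)
    edge-term true  false x m = solve 1 (λ x → con 0ℚ := con 1ℚ :* (con 0ℚ :* x)) refl (seq x m)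
    edge-term false c     x m = sym (ℚ.*-zeroˡ (⟦ c ⟧ * seq x m))

  0≲⇒≤ : ∀ x y → 0≲ (λ m → seq y m - seq x m) → x Defs.≤ y
  0≲⇒≤ x y x≲y ε 0<ε = let K , h = eventually x≲y ε 0<ε in K , λ m K≤m →
    ≤-by-gap (h m K≤m) (solve 3 (λ y x e → y :+ e := x :+ (y :- x :+ e)) refl (seq y m) (seq x m) ε)

  -- The ordered edge sum `X` is the intermediate quantity, bounded above by `X≲ρν√S` and below by
  -- `2∑E≲X`.
  edge-sum-≤ : ∀ {j} → 1 ℕ.≤ n → Defs.IsCliqueNumber G (suc j) →
               fromNat 2 Defs.* ∑E G (λ u v → √ M u v)
               Defs.≤ (Defs.1ℝ Defs.- (Defs.1/ suc j)) Defs.* fromNat n Defs.* √ (∑ λ u → ∑ λ v → M u v)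
  edge-sum-≤ {j} n≥1 isω = 0≲⇒≤ (fromNat 2 Defs.* ∑E G (λ u v → √ M u v))
    ((Defs.1ℝ Defs.- (Defs.1/ suc j)) Defs.* fromNat n Defs.* √ (∑ λ u → ∑ λ v → M u v))
    (0≲-cong
      (λ m → trans
        (solve 3 (λ r x e → r :- x :+ (x :- e) := r :- e) refl (ρ * ν * √≈ m (S m)) (X m) (2ℚ * seq (∑E G λ u v → √ M u v) m))
        (cong (λ s → ρ * ν * √≈ m s - 2ℚ * seq (∑E G λ u v → √ M u v) m) (sym (seq-∑² M m))))
      (0≲-+ (X≲ρν√S (0<fromℕ n≥1)) 2∑E≲X))
    where
    open EdgeWeights A A-sym A-irrefl
    open DoublyNonnegativeSequence a 0≲a a-psd
    open EdgeSum j (free-V isω) using (ρ; ν; S; X≲ρν√S)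
    0<fromℕ : ∀ {k} → 1 ℕ.≤ k → 0ℚ < fromℕ k
    0<fromℕ {suc k} _ = subst (0ℚ <_) (sym (fromℕ-suc k)) (ℚ.+-mono-≤-< (0≤fromℕ k) (ℚ.positive⁻¹ 1ℚ))

open import Defs

lemma1p4 : ∀ (n : ℕ) (n≥1 : 1 ℕ.≤ n) (G : Graph n) (ω : ℕ) (isω : IsCliqueNumber G ω)
    (M : Matrix n) → DoublyNonnegative M →
    fromNat 2 * ∑E G (λ u v → √ M u v)
    ≤ (1ℝ - (1/ ω) {{cliqueNumber-nonZero n≥1 isω}}) * fromNat n * √ (∑ λ u → ∑ λ v → M u v)
lemma1p4 n n≥1 G zero    isω M dnn = contradiction refl (ℕ.≢-nonZero⁻¹ 0 {{cliqueNumber-nonZero n≥1 isω}})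
lemma1p4 n n≥1 G (suc j) isω M dnn = RealBound.edge-sum-≤ G M dnn n≥1 isω
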